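{- Let $k>s$ be positive integers, let $A=A_{k,s}$ be the adjacency matrix of the digraph $D_{k,s}$, and for $n\ge1$ let $b_n^{(k,s)}$ be the number of vertices of $P_{n,k,s}$. Then, as formal power series, $$\sum_{n\geq 0} b_{n+1}^{(k,s)} x^n=\sum_{n\geq 0}\Bigl(\sum_{i,j=1}^k (A^n)_{ij}\Bigr)x^n=\frac{\sum_{i,j=1}^k(-1)^{i+j}Q_{i,j}(x)}{Q(x)},$$ where $Q(x)=\det(I-xA)$ and $Q_{i,j}(x)$ is the determinant of the matrix obtained from $I-xA$ by removing the $j$th row and the $i$th column.
   Context: For positive integers $n,k,s$ let $K=s(n-1)+k$ and let $e_0,\ldots,e_{K-1}$ be the standard basis of $\mathbb{R}^{K}$. For $0\le i\le n-1$ let $\lambda_i=\{si,si+1,\ldots,si+k-1\}$ and $\Delta_{\lambda_i}=\operatorname{conv}\{e_j: j\in\lambda_i\}$. Then $P_{n,k,s}=\sum_{i=0}^{n-1}\Delta_{\lambda_i}$ (Minkowski sum). For $k>s$, $D_{k,s}$ is the digraph with vertex set $\{0,\ldots,k-1\}$ containing all possible arcs (including loops) except the arcs $(s+i',j')$ with $i',j'\in\{0,\ldots,k-1-s\}$ and $i'\neq j'$. Its adjacency matrix $A_{k,s}=(a_{ij})_{i,j=1}^k$ has $a_{ij}=1$ if $(i-1,j-1)$ is an arc and $a_{ij}=0$ otherwise. -}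

module Defs where

open import Algebra.Apartness.Bundles using (HeytingField; HeytingCommutativeRing)
open import Algebra.Bundles using (CommutativeRing)
open import Algebra.Bundles.Raw using (RawRing)
import Algebra.Definitions.RawSemiring as RawSemiringDefinitions
open import Data.Bool.Base using (if_then_else_)
open import Data.Fin.Base using (Fin; zero; suc; toℕ; punchIn)
open import Data.Fin.Properties using (any?; _≟_)
open import Data.Integer.Base using (ℤ; 0ℤ; 1ℤ)
import Data.Integer.Base as ℤ
open import Data.Nat.Base as ℕ using (ℕ; zero; suc; pred; _∸_)
import Data.Nat.Properties as ℕ
open import Data.Product.Base using (Σ; ∃; ∃-syntax; ∃₂; _×_; proj₁)
open import Data.Sum.Base using (_⊎_)
open import Data.Vec.Functional using (Vector)
import Data.Vec.Functional.Relation.Binary.Equality.Setoid as VectorEquality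
open import Function.Bundles using (Bijection; _⇔_)
open import Level using (Level; _⊔_) renaming (suc to lsuc)
open import Relation.Binary.Bundles using (Setoid)
import Relation.Binary.Construct.On as On
open import Relation.Binary.Core using (Rel)
open import Relation.Binary.PropositionalEquality using (_≡_; _≢_)
import Relation.Binary.PropositionalEquality as ≡
open import Relation.Binary.Structures using (IsStrictPartialOrder)
open import Relation.Nullary.Decidable using (Dec; does; ¬?; _×-dec_)
open import Relation.Nullary.Negation using (¬_)
open import Relation.Unary using (Pred; _∈_)

private
  variable
    c ℓ ℓ₁ ℓ₂ ℓ₃ : Level

-- The standard library has no real numbers, so polytopes are defined over
-- an arbitrary ordered field.  The axioms are the constructive ones: the
-- order need not be decidable, and x ≤ y means ¬ (y < x).  They hold for
-- ℚ, for the constructive (Cauchy or Dedekind) reals, and, given excluded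
-- middle, for every ordered field in the usual sense.
-- Nontriviality, 0# < 1# and cotransitivity of _<_ are derivable.

record OrderedField c ℓ₁ ℓ₂ ℓ₃ : Set (lsuc (c ⊔ ℓ₁ ⊔ ℓ₂ ⊔ ℓ₃)) where
  infix 4 _<_ _≤_
  field
    heytingField : HeytingField c ℓ₁ ℓ₂

  open HeytingField heytingField public

  field
    _<_                    : Rel Carrier ℓ₃
    <-isStrictPartialOrder : IsStrictPartialOrder _≈_ _<_
    #⇒<⊎>                  : ∀ {x y} → x # y → x < y ⊎ y < x
    <⇒#                    : ∀ {x y} → x < y → x # y
    +-monoˡ-<              : ∀ z {x y} → x < y → x + z < y + z
    *-positive             : ∀ {x y} → 0# < x → 0# < y → 0# < x * y

  _≤_ : Rel Carrier ℓ₃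
  x ≤ y = ¬ (y < x)

  commutativeRing : CommutativeRing c ℓ₁
  commutativeRing = HeytingCommutativeRing.commutativeRing heytingCommutativeRing

module Matrices (R : RawRing c ℓ) where
  open RawRing R
  open RawSemiringDefinitions rawSemiring using (sum; _^_)

  Matrix : ℕ → Set c
  Matrix m = Fin m → Fin m → Carrier

  𝟙 : ∀ {m} → Matrix m
  𝟙 i j = if does (i ≟ j) then 1# else 0#

  infixl 7 _⊗_
  _⊗_ : ∀ {m} → Matrix m → Matrix m → Matrix m
  (M ⊗ N) i j = sum λ l → M i l * N l j

  infixr 8 _^ᴹ_
  _^ᴹ_ : ∀ {m} → Matrix m → ℕ → Matrix m
  M ^ᴹ zero  = 𝟙
  M ^ᴹ suc n = M ⊗ M ^ᴹ n

  entrySum : ∀ {m} → Matrix m → Carrier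
  entrySum M = sum λ i → sum λ j → M i j

  remove : ∀ {m} (row col : Fin m) → Matrix m → Matrix (pred m)
  remove {suc m} row col M i j = M (punchIn row i) (punchIn col j)

  sign : ℕ → Carrier
  sign n = (- 1#) ^ n

  -- Laplace expansion along the first row.
  det : ∀ {m} → Matrix m → Carrier
  det {zero}  M = 1#
  det {suc m} M = sum λ j → sign (toℕ j) * (M zero j * det {m} (remove zero j M))

module _ (R : RawRing c ℓ) where
  open RawRing R
  open RawSemiringDefinitions rawSemiring using (sum)

  powerSeries : RawRing c ℓ
  powerSeries = record
    { Carrier = ℕ → Carrier
    ; _≈_     = λ f g → ∀ n → f n ≈ g n
    ; _+_     = λ f g n → f n + g n
    ; _*_     = λ f g n → sum {suc n} λ i → f (toℕ i) * g (n ∸ toℕ i)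
    ; -_      = λ f n → - f n
    ; 0#      = λ _ → 0#
    ; 1#      = λ { zero → 1# ; (suc _) → 0# }
    }

  constant : Carrier → RawRing.Carrier powerSeries
  constant a zero    = a
  constant a (suc _) = 0#

  X : RawRing.Carrier powerSeries
  X (suc zero) = 1#
  X _          = 0#

-- f = g / h, in the sense that h is a unit and f = g h⁻¹.
IsQuotient : (R : RawRing c ℓ) (f g h : RawRing.Carrier R) → Set (c ⊔ ℓ)
IsQuotient R f g h = ∃[ h⁻¹ ] (h * h⁻¹ ≈ 1# × f ≈ g * h⁻¹)
  where open RawRing R

ℤ⟦x⟧ : RawRing _ _
ℤ⟦x⟧ = powerSeries ℤ.+-*-rawRing

module Geometry (F : OrderedField c ℓ₁ ℓ₂ ℓ₃) where
  open OrderedField F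
  open CommutativeRing commutativeRing using (rawRing)
  open RawSemiringDefinitions (RawRing.rawSemiring rawRing) using (sum)
  open VectorEquality (CommutativeRing.setoid commutativeRing) using (_≋_; ≋-setoid)

  Point : ℕ → Set c
  Point = Vector Carrier

  infix 7 _·_
  _·_ : ∀ {d} → Point d → Point d → Carrier
  u · x = sum λ l → u l * x l

  e : ∀ {d} → Fin d → Point d
  e = Matrices.𝟙 rawRing

  conv : ∀ {d} → Pred (Point d) ℓ → Pred (Point d) (c ⊔ ℓ₁ ⊔ ℓ₃ ⊔ ℓ)
  conv {d = d} S x =
    ∃[ m ] Σ (Fin m → Point d) λ p → Σ (Fin m → Carrier) λ w →
      (∀ i → p i ∈ S) ×
      (∀ i → 0# ≤ w i) ×
      sum w ≈ 1# ×
      x ≋ (λ l → sum λ i → w i * p i l)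

  MinkowskiSum : ∀ {d n} → (Fin n → Pred (Point d) ℓ) → Pred (Point d) (c ⊔ ℓ₁ ⊔ ℓ)
  MinkowskiSum {d = d} {n} S x =
    Σ (Fin n → Point d) λ y → (∀ i → y i ∈ S i) × x ≋ (λ l → sum λ i → y i l)

  -- v is a vertex when {v} is a face: the set of points of P maximising
  -- some linear functional u is exactly {v}.
  IsVertex : ∀ {d} → Pred (Point d) ℓ → Pred (Point d) (c ⊔ ℓ₁ ⊔ ℓ₃ ⊔ ℓ)
  IsVertex {d = d} P v =
    Σ (Point d) λ u → ∀ x → x ≋ v ⇔ (x ∈ P × (∀ y → y ∈ P → u · y ≤ u · x))

  vertexSetoid : ∀ {d} → Pred (Point d) ℓ → Setoid (c ⊔ ℓ₁ ⊔ ℓ₃ ⊔ ℓ) ℓ₁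
  vertexSetoid {d = d} P = On.setoid {B = ∃ (IsVertex P)} (≋-setoid d) proj₁

  HasVertexCount : ∀ {d} → Pred (Point d) ℓ → ℕ → Set (c ⊔ ℓ₁ ⊔ ℓ₃ ⊔ ℓ)
  HasVertexCount P m = Bijection (≡.setoid (Fin m)) (vertexSetoid P)

  -- conv {e_j : j ∈ λ_i}, where λ_i = {si, si+1, …, si+k-1}.
  blockSimplex : ∀ {d} (k s i : ℕ) → Pred (Point d) (c ⊔ ℓ₁ ⊔ ℓ₃)
  blockSimplex k s i = conv λ x →
    ∃[ j ] (s ℕ.* i ℕ.≤ toℕ j × toℕ j ℕ.< s ℕ.* i ℕ.+ k × x ≋ e j)

  polytope : (n k s : ℕ) → Pred (Point (s ℕ.* (n ∸ 1) ℕ.+ k)) (c ⊔ ℓ₁ ⊔ ℓ₃)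
  polytope n k s = MinkowskiSum {n = n} λ i → blockSimplex k s (toℕ i)

-- The excluded arcs (s+i′, j′), with i′ ≠ j′ in {0, …, k-1-s}.
Excluded : (k s : ℕ) → Rel (Fin k) _
Excluded k s u v = ∃₂ λ (i′ j′ : Fin (k ∸ s)) →
  i′ ≢ j′ × toℕ u ≡ s ℕ.+ toℕ i′ × toℕ v ≡ toℕ j′

Arc : (k s : ℕ) → Rel (Fin k) _
Arc k s u v = ¬ Excluded k s u v

arc? : ∀ k s (u v : Fin k) → Dec (Arc k s u v)
arc? k s u v = ¬? (any? λ i′ → any? λ j′ →
  ¬? (i′ ≟ j′) ×-dec (toℕ u ℕ.≟ s ℕ.+ toℕ i′) ×-dec (toℕ v ℕ.≟ toℕ j′))

open Matrices ℤ.+-*-rawRing public using (_^ᴹ_; entrySum) renaming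
  (Matrix to ℤMatrix)

-- Rows and columns are numbered from 0, like the vertices of the digraph.
adjacency : (k s : ℕ) → ℤMatrix k
adjacency k s u v = if does (arc? k s u v) then 1ℤ else 0ℤ

module _ {k : ℕ} (A : ℤMatrix k) where
  open RawRing ℤ⟦x⟧
  open Matrices ℤ⟦x⟧ using (Matrix; 𝟙; det; remove; sign)
  open RawSemiringDefinitions rawSemiring using (sum)

  I-xA : Matrix k
  I-xA i j = 𝟙 i j + (- (X ℤ.+-*-rawRing * constant ℤ.+-*-rawRing (A i j)))

  Q : Carrier
  Q = det I-xA

  Qᵢⱼ : Fin k → Fin k → Carrier
  Qᵢⱼ i j = det (remove j i I-xA)

  -- With indices from 0 rather than 1, i + j drops by 2 and the sign is unchanged.
  numerator : Carrier
  numerator = sum λ i → sum λ j → sign (toℕ i ℕ.+ toℕ j) * Qᵢⱼ i j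

{-# OPTIONS --safe #-}

-- A vertex of the Minkowski sum is the sum of the vertices e_{J i} of the
-- summands at which a linear functional u has its strict maximum.  Consecutive
-- blocks overlap in k - s positions, and if both J i and J (i + 1) lie in the
-- overlap they must agree; in terms of offsets within the blocks this says
-- that the offsets form a walk in D_{k,s}.  Conversely every walk admits such
-- a functional, constructed block by block from the end of the walk.
--
-- Over an ordered field without decidable order, J is found by choosing in
-- each summand a basis vector with positive weight, and the maximum is only
-- strict up to double negation, which suffices as being an arc is a negation.
--
-- The generating function S = Σ xⁿ Aⁿ satisfies S (I - xA) = I.  Multiplying
-- (I - xA) adj (I - xA) = det (I - xA) I by S gives the quotient formula.

module Submission where

open import Defs
import Algebra.Apartness.Properties.HeytingCommutativeRing as HeytingProperties
open import Algebra.Bundles using (CommutativeRing)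
open import Algebra.Bundles.Raw using (RawRing)
import Algebra.Properties.CommutativeSemigroup as CommutativeSemigroupProperties
import Algebra.Properties.Ring as RingProperties
import Algebra.Properties.Semiring.Sum as SemiringSum
open import Data.Bool.Base using (if_then_else_; true; false)
open import Data.Fin.Base using (Fin; zero; suc; toℕ; fromℕ<; inject₁; punchIn; punchOut; pinch)
open import Data.Fin.Properties
  using (_≟_; punchIn-punchOut; punchInᵢ≢i; toℕ<n; toℕ≤pred[n]; toℕ-fromℕ<; toℕ-injective; toℕ-inject₁)
open import Data.Integer.Base using (ℤ; +_; 0ℤ; 1ℤ)
import Data.Integer.Base as ℤ
import Data.Integer.Properties as ℤ
open import Data.List.Base as List using (List; []; _∷_)
open import Data.List.Membership.Propositional using () renaming (_∈_ to _∈ˡ_)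
open import Data.List.Membership.Propositional.Properties
  using (∈-lookup; ∈-concat⁺′; ∈-concat⁻′; ∈-tabulate⁺; ∈-tabulate⁻; ∈-map⁺; ∈-map⁻)
import Data.List.Properties as List
open import Data.List.Relation.Unary.All as All using ()
import Data.List.Relation.Unary.All.Properties as All
open import Data.List.Relation.Unary.AllPairs using ([]; _∷_)
import Data.List.Relation.Unary.AllPairs.Properties as AllPairs
open import Data.List.Relation.Unary.Any as Any using (here)
import Data.List.Relation.Unary.Any.Properties as Any
open import Data.List.Relation.Unary.Unique.Propositional using (Unique)
import Data.List.Relation.Unary.Unique.Propositional.Properties as Unique
open import Data.Nat.Base as ℕ using (ℕ; zero; suc; _∸_; z≤n; s≤s)
import Data.Nat.Properties as ℕ
open import Data.Product.Base using (Σ; ∃-syntax; _×_; _,_; proj₁; proj₂)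
open import Data.Sum.Base using (_⊎_; inj₁; inj₂; [_,_]′)
open import Data.Vec.Base as Vec using (Vec; []; _∷_; lookup; head)
open import Data.Vec.Functional using (updateAt)
open import Data.Vec.Functional.Properties using (updateAt-updates; updateAt-minimal)
import Data.Vec.Functional.Relation.Binary.Equality.Setoid as VectorEquality
import Data.Vec.Properties as Vec
open import Data.Vec.Relation.Unary.Linked using (Linked; [-]; _∷_)
open import Function.Base using (_∘_; const; id)
open import Function.Bundles using (mk⇔; Equivalence)
open import Level using (0ℓ)
open import Relation.Binary.Core using (Rel)
open import Relation.Binary.Definitions using (Decidable)
open import Relation.Binary.PropositionalEquality as ≡ using (_≡_; _≢_)
import Relation.Binary.Reasoning.Setoid as ≈-Reasoning
open import Relation.Binary.Structures using (IsStrictPartialOrder)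
open import Relation.Nullary.Decidable using (Dec; yes; no; does; dec-true; dec-false)
open import Relation.Nullary.Negation using (contradiction; ¬_)
open import Relation.Unary using (Pred; _∈_)

-- One functional has to make the right choice in all blocks at once, and consecutive blocks compete
-- for the shared coordinates. The walk condition helps because it makes the chosen coordinates
-- nondecreasing: when the second choice lies outside the first block, so do all later ones, and
-- values on the whole first block can be lowered without spoiling them. Functionals take bounded
-- natural values, so that "above everything so far" is available whenever a block is prepended. The
-- same functionals show that distinct walks give distinct vertices: the one selecting a walk takes
-- a strictly smaller value at the point of any other walk. On the algebraic side the determinant is
-- known only through its first row, so the adjugate identity needs expansion along every row and
-- vanishing for equal rows. Both are statements about double sums over ordered pairs of distinct
-- columns. Having `S` as a left inverse is what fits: associativity then gives the adjugate as `S`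
-- times the determinant, without dividing and without knowing that `S` commutes with the matrix.

-- Determinants over a commutative ring: row expansion and the adjugate

-- A pair `(j , l)` encodes the distinct columns `j` and `punchIn j l`; then
-- `(punchIn j l , pinch l j)` encodes the same columns in the other order, and deleting them in
-- either order leaves the same columns.
punchIn-punchIn : ∀ {m} (j : Fin (suc (suc m))) l c →
                  punchIn (punchIn j l) (punchIn (pinch l j) c) ≡ punchIn j (punchIn l c)
punchIn-punchIn zero    _       _       = ≡.refl
punchIn-punchIn (suc j) zero    _       = ≡.refl
punchIn-punchIn (suc j) (suc l) zero    = ≡.refl
punchIn-punchIn (suc j) (suc l) (suc c) = ≡.cong suc (punchIn-punchIn j l c)

punchIn-punchIn-pinch : ∀ {m} (j : Fin (suc m)) l → punchIn (punchIn j l) (pinch l j) ≡ j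
punchIn-punchIn-pinch zero    zero    = ≡.refl
punchIn-punchIn-pinch zero    (suc _) = ≡.refl
punchIn-punchIn-pinch (suc j) zero    = ≡.refl
punchIn-punchIn-pinch (suc j) (suc l) = ≡.cong suc (punchIn-punchIn-pinch j l)

module LinearAlgebra {c ℓ} (R : CommutativeRing c ℓ) where
  open CommutativeRing R hiding (zero)
  open Matrices rawRing renaming (_^ᴹ_ to _^_) hiding (entrySum)
  open RingProperties ring
  open SemiringSum semiring
  open ≈-Reasoning setoid

  infix 4 _≈ᴹ_
  _≈ᴹ_ : ∀ {m} → Matrix m → Matrix m → Set ℓ
  M ≈ᴹ N = ∀ i j → M i j ≈ N i j

  sum-zero : ∀ {m} {f : Fin m → Carrier} → (∀ i → f i ≈ 0#) → sum f ≈ 0#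
  sum-zero {m} f≈0 = trans (sum-cong-≋ f≈0) (sum-replicate-zero m)

  *-interchange : ∀ a b x y → (a * b) * (x * y) ≈ (a * x) * (b * y)
  *-interchange a b x y = begin
    (a * b) * (x * y)  ≈⟨ *-assoc a b (x * y) ⟩
    a * (b * (x * y))  ≈⟨ *-congˡ (*-assoc b x y) ⟨
    a * ((b * x) * y)  ≈⟨ *-congˡ (*-congʳ (*-comm b x)) ⟩
    a * ((x * b) * y)  ≈⟨ *-congˡ (*-assoc x b y) ⟩
    a * (x * (b * y))  ≈⟨ *-assoc a x (b * y) ⟨
    (a * x) * (b * y)  ∎

  ∑-𝟙ʳ : ∀ {m} (f : Fin m → Carrier) j → sum (λ l → f l * 𝟙 j l) ≈ f j
  ∑-𝟙ʳ f zero = begin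
    f zero * 1# + sum (λ l → f (suc l) * 0#)  ≈⟨ +-cong (*-identityʳ _) (sum-zero λ l → zeroʳ (f (suc l))) ⟩
    f zero + 0#                               ≈⟨ +-identityʳ _ ⟩
    f zero                                    ∎
  ∑-𝟙ʳ f (suc j) = begin
    f zero * 0# + sum (λ l → f (suc l) * 𝟙 j l)  ≈⟨ +-cong (zeroʳ _) (∑-𝟙ʳ (f ∘ suc) j) ⟩
    0# + f (suc j)                               ≈⟨ +-identityˡ _ ⟩
    f (suc j)                                    ∎

  𝟙-sym : ∀ {m} (i j : Fin m) → 𝟙 i j ≈ 𝟙 j i
  𝟙-sym zero    zero    = refl
  𝟙-sym zero    (suc j) = refl
  𝟙-sym (suc i) zero    = refl
  𝟙-sym (suc i) (suc j) = 𝟙-sym i j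

  ⊗-congˡ : ∀ {m} (M : Matrix m) {N N′} → N ≈ᴹ N′ → M ⊗ N ≈ᴹ M ⊗ N′
  ⊗-congˡ M N≈N′ i j = sum-cong-≋ λ l → *-congˡ {M i l} (N≈N′ l j)

  ⊗-congʳ : ∀ {m} {M M′ : Matrix m} N → M ≈ᴹ M′ → M ⊗ N ≈ᴹ M′ ⊗ N
  ⊗-congʳ N M≈M′ i j = sum-cong-≋ λ l → *-congʳ {N l j} (M≈M′ i l)

  ⊗-identityˡ : ∀ {m} (M : Matrix m) → 𝟙 ⊗ M ≈ᴹ M
  ⊗-identityˡ M i j = trans (sum-cong-≋ λ l → *-comm (𝟙 i l) (M l j)) (∑-𝟙ʳ (λ l → M l j) i)

  ⊗-identityʳ : ∀ {m} (M : Matrix m) → M ⊗ 𝟙 ≈ᴹ M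
  ⊗-identityʳ M i j = trans (sum-cong-≋ λ l → *-congˡ {M i l} (𝟙-sym l j)) (∑-𝟙ʳ (M i) j)

  ⊗-assoc : ∀ {m} (M N P : Matrix m) → (M ⊗ N) ⊗ P ≈ᴹ M ⊗ (N ⊗ P)
  ⊗-assoc M N P i j = begin
    sum (λ l → sum (λ p → M i p * N p l) * P l j)    ≈⟨ sum-cong-≋ (λ l → *-distribʳ-sum (P l j) (λ p → M i p * N p l)) ⟩
    sum (λ l → sum (λ p → (M i p * N p l) * P l j))  ≈⟨ ∑-comm (λ l p → (M i p * N p l) * P l j) ⟩
    sum (λ p → sum (λ l → (M i p * N p l) * P l j))  ≈⟨ sum-cong-≋ (λ p → sum-cong-≋ λ l → *-assoc (M i p) (N p l) (P l j)) ⟩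
    sum (λ p → sum (λ l → M i p * (N p l * P l j)))  ≈⟨ sum-cong-≋ (λ p → *-distribˡ-sum (M i p) (λ l → N p l * P l j)) ⟨
    sum (λ p → M i p * sum (λ l → N p l * P l j))    ∎

  ^-suc : ∀ {m} (M : Matrix m) n → M ^ suc n ≈ᴹ M ^ n ⊗ M
  ^-suc M zero    i j = trans (⊗-identityʳ M i j) (sym (⊗-identityˡ M i j))
  ^-suc M (suc n) i j = trans (⊗-congˡ M (^-suc M n) i j) (sym (⊗-assoc M (M ^ n) M i j))

  det-cong : ∀ {m} {M N : Matrix m} → M ≈ᴹ N → det M ≈ det N
  det-cong {zero}  M≈N = refl
  det-cong {suc m} M≈N = sum-cong-≋ λ j →
    *-congˡ {sign (toℕ j)} (*-cong (M≈N zero j) (det-cong λ a b → M≈N (suc a) (punchIn j b)))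

  sign-+ : ∀ m n → sign (m ℕ.+ n) ≈ sign m * sign n
  sign-+ zero    n = sym (*-identityˡ _)
  sign-+ (suc m) n = trans (*-congˡ (sign-+ m n)) (sym (*-assoc _ _ _))

  sign-suc : ∀ n → sign (suc n) ≈ - sign n
  sign-suc n = -1*x≈-x (sign n)

  -- The map (j , l) ↦ (punchIn j l , pinch l j) is an involution; it
  -- exchanges the order in which two distinct columns are removed.
  sign-swap : ∀ {m} (j : Fin (suc m)) l →
              sign (toℕ (punchIn j l)) * sign (toℕ (pinch l j)) ≈ - (sign (toℕ j) * sign (toℕ l))
  sign-swap {suc m} zero l = begin
    sign (suc (toℕ l)) * 1#   ≈⟨ *-identityʳ _ ⟩
    sign (suc (toℕ l))        ≈⟨ sign-suc (toℕ l) ⟩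
    - sign (toℕ l)            ≈⟨ -‿cong (*-identityˡ _) ⟨
    - (1# * sign (toℕ l))     ∎
  sign-swap {suc m} (suc j) zero = begin
    1# * sign (toℕ j)           ≈⟨ *-identityˡ _ ⟩
    sign (toℕ j)                ≈⟨ -‿involutive _ ⟨
    - - sign (toℕ j)            ≈⟨ -‿cong (sign-suc (toℕ j)) ⟨
    - sign (suc (toℕ j))        ≈⟨ -‿cong (*-identityʳ _) ⟨
    - (sign (suc (toℕ j)) * 1#) ∎
  sign-swap {suc m} (suc j) (suc l) = begin
    (- 1# * p) * (- 1# * q)    ≈⟨ *-interchange _ _ _ _ ⟩
    (- 1# * - 1#) * (p * q)    ≈⟨ *-congˡ (sign-swap j l) ⟩
    (- 1# * - 1#) * - (a * b)  ≈⟨ -‿distribʳ-* _ _ ⟨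
    - ((- 1# * - 1#) * (a * b)) ≈⟨ -‿cong (*-interchange _ _ _ _) ⟩
    - ((- 1# * a) * (- 1# * b)) ∎
    where
    p = sign (toℕ (punchIn j l))
    q = sign (toℕ (pinch l j))
    a = sign (toℕ j)
    b = sign (toℕ l)

  -- Induction splits off the pairs of columns that contain column zero: `(zero , l)` trades places
  -- with `(suc l , zero)`, and all other pairs are shifts of smaller ones.
  ∑-swap : ∀ {m} (g : Fin (suc m) → Fin m → Carrier) →
           sum (λ j → sum (g j)) ≈ sum (λ j → sum λ l → g (punchIn j l) (pinch l j))
  ∑-swap {zero}  g = refl
  ∑-swap {suc m} g = begin
    sum (g zero) + sum (λ j → g (suc j) zero + sum (λ l → g (suc j) (suc l)))
      ≈⟨ +-congˡ (∑-distrib-+ (λ j → g (suc j) zero) (λ j → sum λ l → g (suc j) (suc l))) ⟩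
    sum (g zero) + (sum (λ j → g (suc j) zero) + sum (λ j → sum λ l → g (suc j) (suc l)))
      ≈⟨ x∙yz≈y∙xz _ _ _ ⟩
    sum (λ j → g (suc j) zero) + (sum (g zero) + sum (λ j → sum λ l → g (suc j) (suc l)))
      ≈⟨ +-congˡ (+-congˡ (∑-swap λ j l → g (suc j) (suc l))) ⟩
    sum (λ j → g (suc j) zero) + (sum (g zero) + sum (λ j → sum λ l → g (suc (punchIn j l)) (suc (pinch l j))))
      ≈⟨ +-congˡ (∑-distrib-+ (g zero) (λ j → sum λ l → g (suc (punchIn j l)) (suc (pinch l j)))) ⟨
    sum (λ j → g (suc j) zero) + sum (λ j → g zero j + sum λ l → g (suc (punchIn j l)) (suc (pinch l j)))
      ∎
    where open CommutativeSemigroupProperties +-commutativeSemigroup using (x∙yz≈y∙xz)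

  -- Reindexing by `∑-swap` would only show that the sum equals its own negative, which does not
  -- make it zero when 2 is a zero divisor. Hence each pair is cancelled against its mirror image.
  ∑-antisymmetric : ∀ {m} (g : Fin (suc m) → Fin m → Carrier) →
                    (∀ j l → g (punchIn j l) (pinch l j) ≈ - g j l) →
                    sum (λ j → sum (g j)) ≈ 0#
  ∑-antisymmetric {zero}  g anti = +-identityʳ 0#
  ∑-antisymmetric {suc m} g anti = begin
    sum (g zero) + sum (λ j → g (suc j) zero + sum (λ l → g (suc j) (suc l)))
      ≈⟨ +-congˡ (∑-distrib-+ (λ j → g (suc j) zero) (λ j → sum λ l → g (suc j) (suc l))) ⟩
    sum (g zero) + (sum (λ j → g (suc j) zero) + sum (λ j → sum λ l → g (suc j) (suc l)))
      ≈⟨ +-assoc _ _ _ ⟨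
    (sum (g zero) + sum (λ j → g (suc j) zero)) + sum (λ j → sum λ l → g (suc j) (suc l))
      ≈⟨ +-cong (sym (∑-distrib-+ (g zero) (λ j → g (suc j) zero))) (∑-antisymmetric (λ j l → g (suc j) (suc l)) λ j l → anti (suc j) (suc l)) ⟩
    sum (λ j → g zero j + g (suc j) zero) + 0#
      ≈⟨ +-identityʳ _ ⟩
    sum (λ j → g zero j + g (suc j) zero)
      ≈⟨ sum-zero (λ j → trans (+-congˡ (anti zero j)) (-‿inverseʳ (g zero j))) ⟩
    0# ∎

  remove² : ∀ {m} (p : Fin (suc (suc m))) (q : Fin (suc m)) → Matrix (suc (suc m)) →
            (j : Fin (suc (suc m))) (l : Fin (suc m)) → Matrix m
  remove² p q M j l = remove q l (remove p j M)

  det-remove²-swap : ∀ {m} p q (M : Matrix (suc (suc m))) j l →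
    det (remove² p q M (punchIn j l) (pinch l j)) ≈ det (remove² p q M j l)
  det-remove²-swap p q M j l = det-cong λ a b →
    reflexive (≡.cong (M (punchIn p (punchIn q a))) (punchIn-punchIn j l b))

  *-∑-interchange : ∀ {m} (a b : Carrier) (s y z : Fin m → Carrier) →
            a * (b * sum (λ l → s l * (y l * z l))) ≈ sum (λ l → (a * s l) * ((b * y l) * z l))
  *-∑-interchange a b s y z = begin
    a * (b * sum (λ l → s l * (y l * z l)))    ≈⟨ *-assoc a b _ ⟨
    (a * b) * sum (λ l → s l * (y l * z l))    ≈⟨ *-distribˡ-sum (a * b) (λ l → s l * (y l * z l)) ⟩
    sum (λ l → (a * b) * (s l * (y l * z l)))  ≈⟨ sum-cong-≋ (λ l → *-interchange a b (s l) (y l * z l)) ⟩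
    sum (λ l → (a * s l) * (b * (y l * z l)))  ≈⟨ sum-cong-≋ (λ l → *-congˡ {a * s l} (*-assoc b (y l) (z l))) ⟨
    sum (λ l → (a * s l) * ((b * y l) * z l))  ∎

  -- Expanding along row zero and then along row `suc i` gives a sum over ordered pairs of columns.
  -- After exchanging the two columns, the inner sum is the first-row expansion of a minor of row
  -- `suc i`, since row zero is the first row of that minor.
  det-expand : ∀ {m} (M : Matrix (suc m)) i →
    det M ≈ sum λ j → sign (toℕ i ℕ.+ toℕ j) * (M i j * det (remove i j M))
  det-expand {m}     M zero    = refl
  det-expand {suc m} M (suc i) = begin
    sum (λ j → sign (toℕ j) * (M zero j * det (remove zero j M)))
      ≈⟨ sum-cong-≋ (λ j → *-congˡ {sign (toℕ j)} (*-congˡ {M zero j} (det-expand (remove zero j M) i))) ⟩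
    sum (λ j → sign (toℕ j) * (M zero j * sum λ l → sign (toℕ i ℕ.+ toℕ l) * (M (suc i) (punchIn j l) * D j l)))
      ≈⟨ sum-cong-≋ (λ j → *-∑-interchange (sign (toℕ j)) (M zero j) (λ l → sign (toℕ i ℕ.+ toℕ l)) (λ l → M (suc i) (punchIn j l)) (D j)) ⟩
    sum (λ j → sum (F j))
      ≈⟨ ∑-swap F ⟩
    sum (λ j → sum λ l → F (punchIn j l) (pinch l j))
      ≈⟨ sum-cong-≋ (λ j → sum-cong-≋ λ l → *-cong (signs j l) (*-cong (entries j l) (det-remove²-swap zero i M j l))) ⟩
    sum (λ j → sum λ l → (sign (suc (toℕ i ℕ.+ toℕ j)) * sign (toℕ l)) * ((M (suc i) j * M zero (punchIn j l)) * D j l))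
      ≈⟨ sum-cong-≋ (λ j → *-∑-interchange (sign (suc (toℕ i ℕ.+ toℕ j))) (M (suc i) j) (λ l → sign (toℕ l)) (λ l → M zero (punchIn j l)) (D j)) ⟨
    sum (λ j → sign (suc (toℕ i ℕ.+ toℕ j)) * (M (suc i) j * det (remove (suc i) j M)))
      ∎
    where
    D : Fin (suc (suc m)) → Fin (suc m) → Carrier
    D j l = det (remove² zero i M j l)
    F : Fin (suc (suc m)) → Fin (suc m) → Carrier
    F j l = (sign (toℕ j) * sign (toℕ i ℕ.+ toℕ l)) * ((M zero j * M (suc i) (punchIn j l)) * D j l)
    entries : ∀ j l → M zero (punchIn j l) * M (suc i) (punchIn (punchIn j l) (pinch l j)) ≈
                      M (suc i) j * M zero (punchIn j l)
    entries j l = trans (*-congˡ (reflexive (≡.cong (M (suc i)) (punchIn-punchIn-pinch j l)))) (*-comm _ _)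
    signs : ∀ j l → sign (toℕ (punchIn j l)) * sign (toℕ i ℕ.+ toℕ (pinch l j)) ≈
                    sign (suc (toℕ i ℕ.+ toℕ j)) * sign (toℕ l)
    signs j l = begin
      p * sign (toℕ i ℕ.+ toℕ (pinch l j))   ≈⟨ *-congˡ (sign-+ (toℕ i) _) ⟩
      p * (sign (toℕ i) * q)                 ≈⟨ x∙yz≈y∙xz p _ q ⟩
      sign (toℕ i) * (p * q)                 ≈⟨ *-congˡ (sign-swap j l) ⟩
      sign (toℕ i) * - (a * b)               ≈⟨ -‿distribʳ-* _ _ ⟨
      - (sign (toℕ i) * (a * b))             ≈⟨ -‿cong (*-assoc _ a b) ⟨
      - ((sign (toℕ i) * a) * b)             ≈⟨ -‿cong (*-congʳ (sign-+ (toℕ i) (toℕ j))) ⟨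
      - (sign (toℕ i ℕ.+ toℕ j) * b)         ≈⟨ -‿distribˡ-* _ b ⟩
      - sign (toℕ i ℕ.+ toℕ j) * b           ≈⟨ *-congʳ (sign-suc (toℕ i ℕ.+ toℕ j)) ⟨
      sign (suc (toℕ i ℕ.+ toℕ j)) * b       ∎
      where
      open CommutativeSemigroupProperties *-commutativeSemigroup using (x∙yz≈y∙xz)
      p = sign (toℕ (punchIn j l))
      q = sign (toℕ (pinch l j))
      a = sign (toℕ j)
      b = sign (toℕ l)

  -- Expansion along both rows gives products of two entries of the same row, symmetric in the two
  -- columns, while the sign is antisymmetric.
  det-equalRows : ∀ {m} (M : Matrix (suc m)) {p q} → p ≢ q → (∀ j → M p j ≈ M q j) → det M ≈ 0#
  det-equalRows {zero}  M {zero} {zero} p≢q _ = contradiction ≡.refl p≢q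
  det-equalRows {suc m} M {p} {q} p≢q Mp≈Mq = begin
    det M
      ≈⟨ det-expand M p ⟩
    sum (λ j → s j * (M p j * det (remove p j M)))
      ≈⟨ sum-cong-≋ (λ j → *-congˡ {s j} (*-congˡ {M p j} (det-expand (remove p j M) q′))) ⟩
    sum (λ j → s j * (M p j * sum λ l → t l * (M (punchIn p q′) (punchIn j l) * D j l)))
      ≈⟨ sum-cong-≋ (λ j → *-congˡ {s j} (*-congˡ {M p j} (sum-cong-≋ λ l → *-congˡ {t l} (*-congʳ {D j l} (row (punchIn j l)))))) ⟩
    sum (λ j → s j * (M p j * sum λ l → t l * (M p (punchIn j l) * D j l)))
      ≈⟨ sum-cong-≋ (λ j → *-∑-interchange (s j) (M p j) t (λ l → M p (punchIn j l)) (D j)) ⟩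
    sum (λ j → sum (F j))
      ≈⟨ ∑-antisymmetric F F-anti ⟩
    0# ∎
    where
    q′ = punchOut p≢q
    s : Fin (suc (suc m)) → Carrier
    s j = sign (toℕ p ℕ.+ toℕ j)
    t : Fin (suc m) → Carrier
    t l = sign (toℕ q′ ℕ.+ toℕ l)
    row : ∀ j → M (punchIn p q′) j ≈ M p j
    row j = trans (reflexive (≡.cong (λ r → M r j) (punchIn-punchOut p≢q))) (sym (Mp≈Mq j))
    D : Fin (suc (suc m)) → Fin (suc m) → Carrier
    D j l = det (remove² p q′ M j l)
    F : Fin (suc (suc m)) → Fin (suc m) → Carrier
    F j l = (s j * t l) * ((M p j * M p (punchIn j l)) * D j l)
    split : ∀ j l → s j * t l ≈ (sign (toℕ p) * sign (toℕ q′)) * (sign (toℕ j) * sign (toℕ l))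
    split j l = trans (*-cong (sign-+ (toℕ p) _) (sign-+ (toℕ q′) _)) (*-interchange _ _ _ _)
    signs : ∀ j l → s (punchIn j l) * t (pinch l j) ≈ - (s j * t l)
    signs j l = begin
      s (punchIn j l) * t (pinch l j)                                  ≈⟨ split _ _ ⟩
      _ * (sign (toℕ (punchIn j l)) * sign (toℕ (pinch l j)))          ≈⟨ *-congˡ (sign-swap j l) ⟩
      _ * - (sign (toℕ j) * sign (toℕ l))                              ≈⟨ -‿distribʳ-* _ _ ⟨
      - (_ * (sign (toℕ j) * sign (toℕ l)))                            ≈⟨ -‿cong (split j l) ⟨
      - (s j * t l)                                                    ∎
    entries : ∀ j l → M p (punchIn j l) * M p (punchIn (punchIn j l) (pinch l j)) ≈ M p j * M p (punchIn j l)
    entries j l = trans (*-congˡ (reflexive (≡.cong (M p) (punchIn-punchIn-pinch j l)))) (*-comm _ _)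
    F-anti : ∀ j l → F (punchIn j l) (pinch l j) ≈ - F j l
    F-anti j l = trans
      (*-cong (signs j l) (*-cong (entries j l) (det-remove²-swap p q′ M j l)))
      (sym (-‿distribˡ-* _ _))

  adjugate : ∀ {m} → Matrix (suc m) → Matrix (suc m)
  adjugate M i j = sign (toℕ i ℕ.+ toℕ j) * det (remove j i M)

  replaceRow : ∀ {m} → Fin m → (Fin m → Carrier) → Matrix m → Matrix m
  replaceRow r v M i j = if does (i ≟ r) then v j else M i j

  -- Entry `(i , j)` is the expansion along row `j` of `M` with row `j` replaced by row `i`. For
  -- `i ≢ j` that matrix has two equal rows.
  ⊗-adjugate : ∀ {m} (M : Matrix (suc m)) → M ⊗ adjugate M ≈ᴹ λ i j → 𝟙 i j * det M
  ⊗-adjugate {m} M i j = begin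
    sum (λ l → M i l * (sign (toℕ l ℕ.+ toℕ j) * det (remove j l M)))
      ≈⟨ sum-cong-≋ (λ l → trans (x∙yz≈y∙xz (M i l) _ _) (*-congʳ {M i l * det (remove j l M)} (reflexive (≡.cong sign (ℕ.+-comm (toℕ l) (toℕ j)))))) ⟩
    sum (λ l → sign (toℕ j ℕ.+ toℕ l) * (M i l * det (remove j l M)))
      ≈⟨ cofactors (i ≟ j) ⟩
    𝟙 i j * det M ∎
    where
    open CommutativeSemigroupProperties *-commutativeSemigroup using (x∙yz≈y∙xz)
    N : Matrix (suc m)
    N = replaceRow j (M i) M
    replaced : ∀ l → N j l ≈ M i l
    replaced l = reflexive (≡.cong (λ b → if b then M i l else M j l) (dec-true (j ≟ j) ≡.refl))
    kept : ∀ {r} → r ≢ j → ∀ l → N r l ≈ M r l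
    kept {r} r≢j l = reflexive (≡.cong (λ b → if b then M i l else M r l) (dec-false (r ≟ j) r≢j))
    cofactors : Dec (i ≡ j) → sum (λ l → sign (toℕ j ℕ.+ toℕ l) * (M i l * det (remove j l M))) ≈ 𝟙 i j * det M
    cofactors (yes ≡.refl) = begin
      _                 ≈⟨ det-expand M i ⟨
      det M             ≈⟨ *-identityˡ _ ⟨
      1# * det M        ≡⟨ ≡.cong (λ b → (if b then 1# else 0#) * det M) (dec-true (i ≟ i) ≡.refl) ⟨
      𝟙 i i * det M     ∎
    cofactors (no i≢j) = begin
      sum (λ l → sign (toℕ j ℕ.+ toℕ l) * (M i l * det (remove j l M)))
        ≈⟨ sum-cong-≋ (λ l → *-congˡ {sign (toℕ j ℕ.+ toℕ l)}
             (*-cong (replaced l) (det-cong λ a b → kept (punchInᵢ≢i j a) (punchIn l b)))) ⟨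
      sum (λ l → sign (toℕ j ℕ.+ toℕ l) * (N j l * det (remove j l N)))
        ≈⟨ det-expand N j ⟨
      det N
        ≈⟨ det-equalRows N i≢j (λ l → trans (kept i≢j l) (sym (replaced l))) ⟩
      0#
        ≈⟨ zeroˡ _ ⟨
      0# * det M
        ≡⟨ ≡.cong (λ b → (if b then 1# else 0#) * det M) (dec-false (i ≟ j) i≢j) ⟨
      𝟙 i j * det M ∎

  leftInverse⇒adjugate : ∀ {m} (S M : Matrix (suc m)) → S ⊗ M ≈ᴹ 𝟙 →
                         adjugate M ≈ᴹ λ i j → S i j * det M
  leftInverse⇒adjugate S M SM≈𝟙 i j = begin
    adjugate M i j                      ≈⟨ ⊗-identityˡ (adjugate M) i j ⟨
    (𝟙 ⊗ adjugate M) i j                ≈⟨ ⊗-congʳ (adjugate M) SM≈𝟙 i j ⟨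
    ((S ⊗ M) ⊗ adjugate M) i j          ≈⟨ ⊗-assoc S M (adjugate M) i j ⟩
    (S ⊗ (M ⊗ adjugate M)) i j          ≈⟨ ⊗-congˡ S (⊗-adjugate M) i j ⟩
    sum (λ l → S i l * (𝟙 l j * det M)) ≈⟨ sum-cong-≋ (λ l → *-assoc (S i l) (𝟙 l j) (det M)) ⟨
    sum (λ l → (S i l * 𝟙 l j) * det M) ≈⟨ *-distribʳ-sum (det M) (λ l → S i l * 𝟙 l j) ⟨
    (S ⊗ 𝟙) i j * det M                 ≈⟨ *-congʳ (⊗-identityʳ S i j) ⟩
    S i j * det M                       ∎

-- The ring of formal power series, with inverses of series of constant term one

module PowerSeries {c ℓ} (R : CommutativeRing c ℓ) where
  open CommutativeRing R hiding (zero)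
  open RingProperties ring
  open SemiringSum semiring
  open LinearAlgebra R using (sum-zero)
  open RawRing (powerSeries rawRing) public using () renaming
    (Carrier to Series; _≈_ to _≈ˢ_; _+_ to _+ˢ_; _*_ to _*ˢ_; -_ to -ˢ_; 0# to 0ˢ; 1# to 1ˢ)
  open ≈-Reasoning setoid

  tail : Series → Series
  tail f n = f (suc n)

  *ˢ-cong : ∀ {f f′ g g′} → f ≈ˢ f′ → g ≈ˢ g′ → f *ˢ g ≈ˢ f′ *ˢ g′
  *ˢ-cong f≈f′ g≈g′ n = sum-cong-≋ {suc n} λ i → *-cong (f≈f′ (toℕ i)) (g≈g′ (n ∸ toℕ i))

  *ˢ-head : ∀ f g → (f *ˢ g) 0 ≈ f 0 * g 0
  *ˢ-head f g = +-identityʳ _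

  *ˢ-distribʳ : ∀ h f g → (f +ˢ g) *ˢ h ≈ˢ (f *ˢ h) +ˢ (g *ˢ h)
  *ˢ-distribʳ h f g n = trans
    (sum-cong-≋ {suc n} λ i → distribʳ (h (n ∸ toℕ i)) (f (toℕ i)) (g (toℕ i)))
    (∑-distrib-+ {suc n} (λ i → f (toℕ i) * h (n ∸ toℕ i)) (λ i → g (toℕ i) * h (n ∸ toℕ i)))

  *ˢ-scale : ∀ a f g → (λ n → a * f n) *ˢ g ≈ˢ λ n → a * (f *ˢ g) n
  *ˢ-scale a f g n = trans
    (sum-cong-≋ {suc n} λ i → *-assoc a (f (toℕ i)) (g (n ∸ toℕ i)))
    (sym (*-distribˡ-sum {suc n} a (λ i → f (toℕ i) * g (n ∸ toℕ i))))

  *ˢ-zeroˡ : ∀ f → 0ˢ *ˢ f ≈ˢ 0ˢ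
  *ˢ-zeroˡ f n = sum-zero {suc n} λ i → zeroˡ (f (n ∸ toℕ i))

  -- (f *ˢ g) (suc n) ≡ f 0 * g (suc n) + (tail f *ˢ g) n holds by
  -- computation; this is the mirror image.
  *ˢ-suc : ∀ f g n → (f *ˢ g) (suc n) ≈ f (suc n) * g 0 + (f *ˢ tail g) n
  *ˢ-suc f g zero = begin
    f 0 * g 1 + (f 1 * g 0 + 0#)  ≈⟨ x∙yz≈y∙xz _ _ _ ⟩
    f 1 * g 0 + (f 0 * g 1 + 0#)  ∎
    where open CommutativeSemigroupProperties +-commutativeSemigroup using (x∙yz≈y∙xz)
  *ˢ-suc f g (suc n) = begin
    f 0 * g (suc (suc n)) + (tail f *ˢ g) (suc n)                       ≈⟨ +-congˡ (*ˢ-suc (tail f) g n) ⟩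
    f 0 * g (suc (suc n)) + (tail f (suc n) * g 0 + (tail f *ˢ tail g) n) ≈⟨ x∙yz≈y∙xz _ _ _ ⟩
    tail f (suc n) * g 0 + (f 0 * g (suc (suc n)) + (tail f *ˢ tail g) n) ∎
    where open CommutativeSemigroupProperties +-commutativeSemigroup using (x∙yz≈y∙xz)

  *ˢ-comm : ∀ f g → f *ˢ g ≈ˢ g *ˢ f
  *ˢ-comm f g zero    = +-congʳ (*-comm (f 0) (g 0))
  *ˢ-comm f g (suc n) = begin
    f 0 * g (suc n) + (tail f *ˢ g) n  ≈⟨ +-cong (*-comm _ _) (*ˢ-comm (tail f) g n) ⟩
    g (suc n) * f 0 + (g *ˢ tail f) n  ≈⟨ *ˢ-suc g f n ⟨
    (g *ˢ f) (suc n)                   ∎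

  *ˢ-assoc : ∀ f g h → (f *ˢ g) *ˢ h ≈ˢ f *ˢ (g *ˢ h)
  *ˢ-assoc f g h zero = begin
    ((f *ˢ g) *ˢ h) 0      ≈⟨ *ˢ-head (f *ˢ g) h ⟩
    (f *ˢ g) 0 * h 0       ≈⟨ *-congʳ (*ˢ-head f g) ⟩
    f 0 * g 0 * h 0        ≈⟨ *-assoc _ _ _ ⟩
    f 0 * (g 0 * h 0)      ≈⟨ *-congˡ (*ˢ-head g h) ⟨
    f 0 * (g *ˢ h) 0       ≈⟨ *ˢ-head f (g *ˢ h) ⟨
    (f *ˢ (g *ˢ h)) 0      ∎
  -- By computation, the tail of `f *ˢ g` is `f 0` times `tail g` plus `tail f *ˢ g`; distributivity
  -- and scaling then reduce the claim to the one for `tail f`.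
  *ˢ-assoc f g h (suc n) = begin
    (f *ˢ g) 0 * h (suc n) + (((λ m → f 0 * tail g m) +ˢ (tail f *ˢ g)) *ˢ h) n
      ≈⟨ +-cong (trans (*-congʳ (*ˢ-head f g)) (*-assoc _ _ _))
           (*ˢ-distribʳ h (λ m → f 0 * tail g m) (tail f *ˢ g) n) ⟩
    f 0 * (g 0 * h (suc n)) + (((λ m → f 0 * tail g m) *ˢ h) n + ((tail f *ˢ g) *ˢ h) n)
      ≈⟨ +-congˡ (+-cong (*ˢ-scale (f 0) (tail g) h n) (*ˢ-assoc (tail f) g h n)) ⟩
    f 0 * (g 0 * h (suc n)) + (f 0 * (tail g *ˢ h) n + (tail f *ˢ (g *ˢ h)) n)
      ≈⟨ +-assoc _ _ _ ⟨
    (f 0 * (g 0 * h (suc n)) + f 0 * (tail g *ˢ h) n) + (tail f *ˢ (g *ˢ h)) n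
      ≈⟨ +-congʳ (distribˡ _ _ _) ⟨
    f 0 * (g *ˢ h) (suc n) + (tail f *ˢ (g *ˢ h)) n ∎

  *ˢ-identityˡ : ∀ f → 1ˢ *ˢ f ≈ˢ f
  *ˢ-identityˡ f zero    = trans (*ˢ-head 1ˢ f) (*-identityˡ _)
  *ˢ-identityˡ f (suc n) = trans (+-cong (*-identityˡ _) (*ˢ-zeroˡ f n)) (+-identityʳ _)

  seriesRing : CommutativeRing c ℓ
  seriesRing = record
    { _≈_ = _≈ˢ_
    ; _+_ = _+ˢ_
    ; _*_ = _*ˢ_
    ; -_  = -ˢ_
    ; 0#  = 0ˢ
    ; 1#  = 1ˢ
    ; isCommutativeRing = record
      { isRing = record
        { +-isAbelianGroup = record
          { isGroup = record
            { isMonoid = record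
              { isSemigroup = record
                { isMagma = record
                  { isEquivalence = record
                    { refl  = λ n → refl
                    ; sym   = λ f≈g n → sym (f≈g n)
                    ; trans = λ f≈g g≈h n → trans (f≈g n) (g≈h n)
                    }
                  ; ∙-cong = λ f≈f′ g≈g′ n → +-cong (f≈f′ n) (g≈g′ n)
                  }
                ; assoc = λ f g h n → +-assoc (f n) (g n) (h n)
                }
              ; identity = (λ f n → +-identityˡ (f n)) , λ f n → +-identityʳ (f n)
              }
            ; inverse = (λ f n → -‿inverseˡ (f n)) , λ f n → -‿inverseʳ (f n)
            ; ⁻¹-cong = λ f≈g n → -‿cong (f≈g n)
            }
          ; comm = λ f g n → +-comm (f n) (g n)
          }
        ; *-cong = *ˢ-cong
        ; *-assoc = *ˢ-assoc
        ; *-identity = *ˢ-identityˡ , λ f n → trans (*ˢ-comm f 1ˢ n) (*ˢ-identityˡ f n)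
        ; distrib = (λ f g h n → trans (*ˢ-comm f (g +ˢ h) n) (trans (*ˢ-distribʳ f g h n)
                      (+-cong (*ˢ-comm g f n) (*ˢ-comm h f n)))) , *ˢ-distribʳ
        }
      ; *-comm = *ˢ-comm
      }
    }

  private
    module S = CommutativeRing seriesRing
    module ΣS = SemiringSum S.semiring

  sum-coeff : ∀ {m} (f : Fin m → Series) n → ΣS.sum f n ≈ sum (λ i → f i n)
  sum-coeff {zero}  f n = refl
  sum-coeff {suc m} f n = +-congˡ (sum-coeff (f ∘ suc) n)

  -- firstCoeffs f n lists the coefficients n, n - 1, …, 0 of the inverse of f.
  firstCoeffs : Series → ∀ n → Fin (suc n) → Carrier
  firstCoeffs f zero    zero    = 1#
  firstCoeffs f (suc n) zero    = - sum {suc n} (λ i → f (suc (toℕ i)) * firstCoeffs f n i)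
  firstCoeffs f (suc n) (suc i) = firstCoeffs f n i

  -- Each coefficient depends on all earlier ones, which is why the recursion carries them along.
  -- Its initial value 1 fits a constant term 1, where no division occurs.
  inverse : Series → Series
  inverse f n = firstCoeffs f n zero

  firstCoeffs-inverse : ∀ f n i → firstCoeffs f n i ≡ inverse f (n ∸ toℕ i)
  firstCoeffs-inverse f n       zero    = ≡.refl
  firstCoeffs-inverse f (suc n) (suc i) = firstCoeffs-inverse f n i

  *ˢ-inverse : ∀ f → f 0 ≈ 1# → f *ˢ inverse f ≈ˢ 1ˢ
  *ˢ-inverse f f₀≈1 zero    = trans (*ˢ-head f (inverse f)) (trans (*-identityʳ _) f₀≈1)
  *ˢ-inverse f f₀≈1 (suc n) = begin
    f 0 * inverse f (suc n) + (tail f *ˢ inverse f) n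
      ≈⟨ +-cong (trans (*-congʳ f₀≈1) (*-identityˡ _))
           (sum-cong-≋ {suc n} λ i → *-congˡ {f (suc (toℕ i))} (reflexive (≡.sym (firstCoeffs-inverse f n i)))) ⟩
    - sum {suc n} (λ i → f (suc (toℕ i)) * firstCoeffs f n i) + sum {suc n} (λ i → f (suc (toℕ i)) * firstCoeffs f n i)
      ≈⟨ -‿inverseˡ _ ⟩
    0# ∎

  *ˢ-constant : ∀ f a n → (f *ˢ constant rawRing a) n ≈ f n * a
  *ˢ-constant f a zero    = *ˢ-head f (constant rawRing a)
  *ˢ-constant f a (suc n) = begin
    (f *ˢ constant rawRing a) (suc n)   ≈⟨ *ˢ-suc f (constant rawRing a) n ⟩
    f (suc n) * a + (f *ˢ 0ˢ) n         ≈⟨ +-congˡ (S.zeroʳ f n) ⟩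
    f (suc n) * a + 0#                  ≈⟨ +-identityʳ _ ⟩
    f (suc n) * a                       ∎

  X-*ˢ-suc : ∀ f n → (X rawRing *ˢ f) (suc n) ≈ f n
  X-*ˢ-suc f n = begin
    0# * f (suc n) + (tail (X rawRing) *ˢ f) n  ≈⟨ +-cong (zeroˡ _) (*ˢ-cong {g = f} tail-X (λ _ → refl) n) ⟩
    0# + (1ˢ *ˢ f) n                            ≈⟨ +-identityˡ _ ⟩
    (1ˢ *ˢ f) n                                 ≈⟨ *ˢ-identityˡ f n ⟩
    f n                                         ∎
    where
    tail-X : tail (X rawRing) ≈ˢ 1ˢ
    tail-X zero    = refl
    tail-X (suc n) = refl

  X-*ˢ-head : ∀ f → (X rawRing *ˢ f) 0 ≈ 0#
  X-*ˢ-head f = trans (*ˢ-head (X rawRing) f) (zeroˡ _)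

  module _ where
    open Matrices (powerSeries rawRing) using (Matrix; 𝟙; det; remove)

    𝟙-coeff₀ : ∀ {m} (i j : Fin m) → 𝟙 i j 0 ≡ Matrices.𝟙 rawRing i j
    𝟙-coeff₀ i j with does (i ≟ j)
    ... | true  = ≡.refl
    ... | false = ≡.refl

    𝟙-coeff₊ : ∀ {m} (i j : Fin m) n → 𝟙 i j (suc n) ≡ 0#
    𝟙-coeff₊ i j n with does (i ≟ j)
    ... | true  = ≡.refl
    ... | false = ≡.refl

    -- Constant terms multiply, so an off-diagonal zero kills every term of the first-row expansion
    -- but the first.
    det-head : ∀ {m} (M : Matrix m) → (∀ i j → M i j 0 ≈ Matrices.𝟙 rawRing i j) → det M 0 ≈ 1#
    det-head {zero}  M M₀≈𝟙 = refl
    det-head {suc m} M M₀≈𝟙 = begin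
      det M 0                         ≈⟨ sum-coeff t 0 ⟩
      t zero 0 + sum (λ j → t (suc j) 0)
        ≈⟨ +-cong first (sum-zero λ j → rest j) ⟩
      1# + 0#                         ≈⟨ +-identityʳ 1# ⟩
      1#                              ∎
      where
      minor : Fin (suc m) → Series
      minor j = det (remove zero j M)
      t : Fin (suc m) → Series
      t j = Matrices.sign (powerSeries rawRing) (toℕ j) *ˢ (M zero j *ˢ minor j)
      first : t zero 0 ≈ 1#
      first = begin
        t zero 0                        ≈⟨ *ˢ-identityˡ (M zero zero *ˢ minor zero) 0 ⟩
        (M zero zero *ˢ minor zero) 0   ≈⟨ *ˢ-head (M zero zero) (minor zero) ⟩
        M zero zero 0 * minor zero 0    ≈⟨ *-cong (M₀≈𝟙 zero zero) (det-head {m} (remove zero zero M) λ i j → M₀≈𝟙 (suc i) (suc j)) ⟩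
        1# * 1#                         ≈⟨ *-identityˡ 1# ⟩
        1#                              ∎
      rest : ∀ j → t (suc j) 0 ≈ 0#
      rest j = begin
        t (suc j) 0                                             ≈⟨ *ˢ-head (Matrices.sign (powerSeries rawRing) (toℕ (suc j))) (M zero (suc j) *ˢ minor (suc j)) ⟩
        σ * (M zero (suc j) *ˢ minor (suc j)) 0                 ≈⟨ *-congˡ (*ˢ-head (M zero (suc j)) (minor (suc j))) ⟩
        σ * (M zero (suc j) 0 * minor (suc j) 0)                ≈⟨ *-congˡ (*-congʳ (M₀≈𝟙 zero (suc j))) ⟩
        σ * (0# * minor (suc j) 0)                              ≈⟨ *-congˡ (zeroˡ _) ⟩
        σ * 0#                                                  ≈⟨ zeroʳ _ ⟩
        0#                                                      ∎
        where σ = Matrices.sign (powerSeries rawRing) (toℕ (suc j)) 0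

-- The generating function of the powers of an integer matrix

module ℤSeries where
  open PowerSeries ℤ.+-*-commutativeRing public
  module S = CommutativeRing seriesRing
  module L = LinearAlgebra seriesRing
  module Lℤ = LinearAlgebra ℤ.+-*-commutativeRing
  module ΣS = SemiringSum S.semiring
  module Σℤ = SemiringSum ℤ.+-*-semiring
  open Matrices ℤ⟦x⟧ using (Matrix; 𝟙; _⊗_)

  -- A matrix of series rather than a series of matrices, so that linear algebra over the ring of
  -- series applies to it.
  powers : ∀ {m} → ℤMatrix m → Matrix m
  powers A i j n = (A ^ᴹ n) i j

  powers-inverse : ∀ {m} (A : ℤMatrix m) → powers A ⊗ I-xA A L.≈ᴹ 𝟙
  powers-inverse A i j = begin
    ΣS.sum (λ l → S i l * (𝟙 l j - X′ * a l))
      ≈⟨ ΣS.sum-cong-≋ (λ l → expand (S i l) (𝟙 l j) (a l)) ⟩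
    ΣS.sum (λ l → S i l * 𝟙 l j + (- X′) * (S i l * a l))
      ≈⟨ ΣS.∑-distrib-+ (λ l → S i l * 𝟙 l j) (λ l → (- X′) * (S i l * a l)) ⟩
    (S ⊗ 𝟙) i j + ΣS.sum (λ l → (- X′) * (S i l * a l))
      ≈⟨ +-cong (L.⊗-identityʳ S i j) (sym (ΣS.*-distribˡ-sum (- X′) (λ l → S i l * a l))) ⟩
    S i j + (- X′) * T
      ≈⟨ +-congˡ {S i j} (-‿distribˡ-* X′ T) ⟨
    S i j - X′ * T
      ≈⟨ telescope ⟩
    𝟙 i j ∎
    where
    open S
    open RingProperties S.ring
    open ≈-Reasoning S.setoid
    S = powers A
    X′ = X ℤ.+-*-rawRing
    a : _ → Series
    a l = constant ℤ.+-*-rawRing (A l j)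
    T = ΣS.sum (λ l → S i l * a l)
    expand : ∀ s d y → s * (d - X′ * y) ≈ s * d + (- X′) * (s * y)
    expand s d y = begin
      s * (d - X′ * y)           ≈⟨ distribˡ s d _ ⟩
      s * d + s * - (X′ * y)     ≈⟨ +-congˡ {s * d} (*-congˡ {s} (-‿distribˡ-* X′ y)) ⟩
      s * d + s * (- X′ * y)     ≈⟨ +-congˡ {s * d} (x∙yz≈y∙xz s (- X′) y) ⟩
      s * d + - X′ * (s * y)     ∎
      where open CommutativeSemigroupProperties S.*-commutativeSemigroup using (x∙yz≈y∙xz)
    -- Powers are defined by multiplication on the left, but here `A` arrives on the right; `^-suc`
    -- mediates.
    T-coeff : ∀ n → T n ≡ (A ^ᴹ suc n) i j
    T-coeff n = ≡.trans (sum-coeff (λ l → S i l * a l) n)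
      (≡.trans (Σℤ.sum-cong-≋ (λ l → *ˢ-constant (S i l) (A l j) n)) (≡.sym (Lℤ.^-suc A n i j)))
    telescope : S i j - X′ * T ≈ 𝟙 i j
    telescope zero    = ≡.trans (≡.cong (λ z → Matrices.𝟙 ℤ.+-*-rawRing i j ℤ.+ ℤ.- z) (X-*ˢ-head T))
      (≡.trans (ℤ.+-identityʳ _) (≡.sym (𝟙-coeff₀ i j)))
    telescope (suc n) = ≡.trans (≡.cong (λ z → (A ^ᴹ suc n) i j ℤ.+ ℤ.- z) (≡.trans (X-*ˢ-suc T n) (T-coeff n)))
      (≡.trans (ℤ.+-inverseʳ ((A ^ᴹ suc n) i j)) (≡.sym (𝟙-coeff₊ i j n)))

  Q-head : ∀ {m} (A : ℤMatrix m) → Q A 0 ≡ 1ℤ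
  Q-head A = det-head (I-xA A) λ i j → ≡.trans
    (≡.cong₂ (λ y z → y ℤ.+ ℤ.- z) (𝟙-coeff₀ i j) (X-*ˢ-head (constant ℤ.+-*-rawRing (A i j))))
    (ℤ.+-identityʳ _)

  entrySum-quotient : ∀ {m} (A : ℤMatrix (suc m)) →
                      IsQuotient ℤ⟦x⟧ (λ n → entrySum (A ^ᴹ n)) (numerator A) (Q A)
  entrySum-quotient {m} A = inverse (Q A) , *ˢ-inverse (Q A) (Q-head A) , (begin
    (λ n → entrySum (A ^ᴹ n))    ≈⟨ (λ n → coeff n) ⟨
    Σ²                           ≈⟨ *-identityʳ Σ² ⟨
    Σ² * 1#                      ≈⟨ *-congˡ {Σ²} (*ˢ-inverse (Q A) (Q-head A)) ⟨
    Σ² * (Q A * inverse (Q A))   ≈⟨ *-assoc Σ² (Q A) (inverse (Q A)) ⟨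
    (Σ² * Q A) * inverse (Q A)   ≈⟨ *-congʳ {inverse (Q A)} numerator-eq ⟨
    numerator A * inverse (Q A)  ∎)
    where
    open S
    open ≈-Reasoning S.setoid
    S = powers A
    Σ² = ΣS.sum λ i → ΣS.sum λ j → S i j
    coeff : ∀ n → Σ² n ≡ entrySum (A ^ᴹ n)
    coeff n = ≡.trans (sum-coeff (λ i → ΣS.sum λ j → S i j) n) (Σℤ.sum-cong-≋ λ i → sum-coeff (S i) n)
    numerator-eq : numerator A ≈ Σ² * Q A
    numerator-eq = begin
      numerator A
        -- The signed `Qᵢⱼ A i j` is entry `(i , j)` of the adjugate by definition, the
        -- transposition being built into `Qᵢⱼ`.
        ≈⟨ ΣS.sum-cong-≋ (λ i → ΣS.sum-cong-≋ λ j → L.leftInverse⇒adjugate S (I-xA A) (powers-inverse A) i j) ⟩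
      ΣS.sum (λ i → ΣS.sum λ j → S i j * Q A)
        ≈⟨ ΣS.sum-cong-≋ (λ i → ΣS.*-distribʳ-sum (Q A) (S i)) ⟨
      ΣS.sum (λ i → ΣS.sum (S i) * Q A)
        ≈⟨ ΣS.*-distribʳ-sum (Q A) (λ i → ΣS.sum (S i)) ⟨
      Σ² * Q A ∎

-- Exchanging one entry, and inequalities between finite sums in an ordered field

-- Serves the exchange arguments, in which one summand, generator or choice is replaced and the
-- family must stay admissible or not get worse.
updateAt-all : ∀ {a p} {A : Set a} {m} (P : Fin m → A → Set p) (f : Fin m → A) i a →
               (∀ j → P j (f j)) → P i a → ∀ j → P j (updateAt f i (const a) j)
updateAt-all P f i a Pf Pa j with j ≟ i
... | yes ≡.refl = ≡.subst (P i) (≡.sym (updateAt-updates i f)) Pa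
... | no  j≢i    = ≡.subst (P j) (≡.sym (updateAt-minimal j i f j≢i)) (Pf j)

module OrderedFieldProperties {c ℓ₁ ℓ₂ ℓ₃} (F : OrderedField c ℓ₁ ℓ₂ ℓ₃) where
  open OrderedField F hiding (zero; setoid)
  open CommutativeRing commutativeRing using (ring; semiring; setoid)
  open RingProperties ring
  open SemiringSum semiring
  open HeytingProperties heytingCommutativeRing using (1#0; x-0≈x; invertibleˡ⇒#)
  private module < = IsStrictPartialOrder <-isStrictPartialOrder
  open ≈-Reasoning setoid

  <-respˡ : ∀ {x y z} → x ≈ y → x < z → y < z
  <-respˡ = <.<-respˡ-≈

  <-respʳ : ∀ {x y z} → x ≈ y → z < x → z < y
  <-respʳ = <.<-respʳ-≈

  <-resp : ∀ {x x′ y y′} → x ≈ x′ → y ≈ y′ → x < y → x′ < y′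
  <-resp x≈x′ y≈y′ = <-respˡ x≈x′ ∘ <-respʳ y≈y′

  ≤-resp : ∀ {x x′ y y′} → x ≈ x′ → y ≈ y′ → x ≤ y → x′ ≤ y′
  ≤-resp x≈x′ y≈y′ x≤y y′<x′ = x≤y (<-resp (sym y≈y′) (sym x≈x′) y′<x′)

  <-irrefl : ∀ {x y} → x ≈ y → ¬ x < y
  <-irrefl = <.irrefl

  <-trans : ∀ {x y z} → x < y → y < z → x < z
  <-trans = <.trans

  <⇒≤ : ∀ {x y} → x < y → x ≤ y
  <⇒≤ = <.asym

  ≤-reflexive : ∀ {x y} → x ≈ y → x ≤ y
  ≤-reflexive x≈y = <-irrefl (sym x≈y)

  -- The substitute for trichotomy: apartness is cotransitive, and apart elements are comparable.
  <-cotrans : ∀ {x y} → x < y → ∀ z → x < z ⊎ z < y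
  <-cotrans x<y z with #-cotrans (<⇒# x<y) z
  ... | inj₁ x#z = [ inj₁ , (λ z<x → inj₂ (<-trans z<x x<y)) ]′ (#⇒<⊎> x#z)
  ... | inj₂ z#y = [ inj₂ , (λ y<z → inj₁ (<-trans x<y y<z)) ]′ (#⇒<⊎> z#y)

  ≤-trans : ∀ {x y z} → x ≤ y → y ≤ z → x ≤ z
  ≤-trans {y = y} x≤y y≤z z<x = [ y≤z , x≤y ]′ (<-cotrans z<x y)

  <-≤-trans : ∀ {x y z} → x < y → y ≤ z → x < z
  <-≤-trans {z = z} x<y y≤z = [ id , (λ z<y → contradiction z<y y≤z) ]′ (<-cotrans x<y z)

  +-monoʳ-< : ∀ z {x y} → x < y → z + x < z + y
  +-monoʳ-< z x<y = <-resp (+-comm _ z) (+-comm _ z) (+-monoˡ-< z x<y)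

  +-cancelʳ-< : ∀ z {x y} → x + z < y + z → x < y
  +-cancelʳ-< z = <-resp (cancel _) (cancel _) ∘ +-monoˡ-< (- z)
    where
    cancel : ∀ x → x + z + - z ≈ x
    cancel x = trans (+-assoc x z (- z)) (trans (+-congˡ (-‿inverseʳ z)) (+-identityʳ x))

  +-cancelˡ-< : ∀ z {x y} → z + x < z + y → x < y
  +-cancelˡ-< z = +-cancelʳ-< z ∘ <-resp (+-comm z _) (+-comm z _)

  0<1 : 0# < 1#
  0<1 with #⇒<⊎> 1#0
  ... | inj₂ 0<1 = 0<1
  ... | inj₁ 1<0 = contradiction 1<0 (<⇒≤ (<-respʳ -1*-1≈1 (*-positive 0<-1 0<-1)))
    where
    0<-1 : 0# < - 1#
    0<-1 = <-resp (-‿inverseʳ 1#) (+-identityˡ (- 1#)) (+-monoˡ-< (- 1#) 1<0)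
    -1*-1≈1 : - 1# * - 1# ≈ 1#
    -1*-1≈1 = trans (-1*x≈-x (- 1#)) (-‿involutive 1#)

  *-monoˡ-< : ∀ {w x y} → 0# < w → x < y → w * x < w * y
  *-monoˡ-< {w} {x} {y} 0<w x<y = +-cancelʳ-< (- (w * x)) (<-resp
    (sym (-‿inverseʳ (w * x)))
    (trans (distribˡ w y (- x)) (+-congˡ (sym (-‿distribʳ-* w x))))
    (*-positive 0<w (<-respˡ (-‿inverseʳ x) (+-monoˡ-< (- x) x<y))))

  -- If `z` inverts `w * (x - y)`, then `z * (x - y)` inverts `w` and `z * w` inverts `x - y`.
  *-#⇒# : ∀ {w x y} → w * x # w * y → w # 0# × x # y
  *-#⇒# {w} {x} {y} wx#wy with #⇒invertible wx#wy
  ... | z , zd≈1 , _ =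
    invertibleˡ⇒# (z * (x - y) , (begin
      z * (x - y) * (w - 0#)  ≈⟨ *-congˡ (x-0≈x w) ⟩
      z * (x - y) * w         ≈⟨ *-assoc z (x - y) w ⟩
      z * ((x - y) * w)       ≈⟨ *-congˡ (*-comm (x - y) w) ⟩
      z * (w * (x - y))       ≈⟨ unit ⟩
      1#                      ∎)) ,
    invertibleˡ⇒# (z * w , trans (*-assoc z w (x - y)) unit)
    where
    unit : z * (w * (x - y)) ≈ 1#
    unit = begin
      z * (w * (x - y))        ≈⟨ *-congˡ (distribˡ w x (- y)) ⟩
      z * (w * x + w * - y)    ≈⟨ *-congˡ (+-congˡ (-‿distribʳ-* w y)) ⟨
      z * (w * x - w * y)      ≈⟨ zd≈1 ⟩
      1#                       ∎

  0≤∧#⇒0< : ∀ {w} → 0# ≤ w → w # 0# → 0# < w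
  0≤∧#⇒0< 0≤w w#0 = [ (λ w<0 → contradiction w<0 0≤w) , id ]′ (#⇒<⊎> w#0)

  -- A weight with `0# ≤ w` cannot be split into zero or positive; the inequality to be refuted
  -- itself supplies `w # 0#`.
  *-monoˡ-≤ : ∀ {w x y} → 0# ≤ w → x ≤ y → w * x ≤ w * y
  *-monoˡ-≤ 0≤w x≤y wy<wx with *-#⇒# (<⇒# wy<wx)
  ... | w#0 , y#x = [ x≤y , (λ x<y → <⇒≤ wy<wx (*-monoˡ-< (0≤∧#⇒0< 0≤w w#0) x<y)) ]′ (#⇒<⊎> y#x)

  -- Cotransitivity at the mixed sum `g zero + sum (f ∘ suc)` tells whether the first term or the
  -- remaining ones can account for the inequality.
  sum-<⇒∃< : ∀ {m} {f g : Fin m → Carrier} → sum f < sum g → ∃[ i ] f i < g i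
  sum-<⇒∃< {zero}          0<0 = contradiction 0<0 (<-irrefl refl)
  sum-<⇒∃< {suc m} {f} {g} f<g with <-cotrans f<g (g zero + sum (f ∘ suc))
  ... | inj₁ f₀<g₀ = zero , +-cancelʳ-< (sum (f ∘ suc)) f₀<g₀
  ... | inj₂ f<g′ with sum-<⇒∃< (+-cancelˡ-< (g zero) f<g′)
  ...   | i , fᵢ<gᵢ = suc i , fᵢ<gᵢ

  sum-#⇒∃# : ∀ {m} {f g : Fin m → Carrier} → sum f # sum g → ∃[ i ] f i # g i
  sum-#⇒∃# f#g with #⇒<⊎> f#g
  ... | inj₁ f<g = let i , fᵢ<gᵢ = sum-<⇒∃< f<g in i , <⇒# fᵢ<gᵢ
  ... | inj₂ g<f = let i , gᵢ<fᵢ = sum-<⇒∃< g<f in i , #-sym (<⇒# gᵢ<fᵢ)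

  sum-mono-≤ : ∀ {m} {f g : Fin m → Carrier} → (∀ i → f i ≤ g i) → sum f ≤ sum g
  sum-mono-≤ f≤g g<f = let i , gᵢ<fᵢ = sum-<⇒∃< g<f in f≤g i gᵢ<fᵢ

  sum-mono-< : ∀ {m} {f g : Fin m → Carrier} → (∀ i → f i ≤ g i) → ∀ i → f i < g i → sum f < sum g
  sum-mono-< {f = f} {g} f≤g zero fᵢ<gᵢ =
    <-≤-trans (+-monoˡ-< (sum (f ∘ suc)) fᵢ<gᵢ) (sum-mono-≤ (f≤g ∘ suc) ∘ +-cancelˡ-< (g zero))
  sum-mono-< {f = f} {g} f≤g (suc i) fᵢ<gᵢ =
    <-≤-trans (+-monoʳ-< (f zero) (sum-mono-< (f≤g ∘ suc) i fᵢ<gᵢ)) (f≤g zero ∘ +-cancelʳ-< (sum (g ∘ suc)))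

  fromℕ : ℕ → Carrier
  fromℕ zero    = 0#
  fromℕ (suc n) = 1# + fromℕ n

  fromℕ-mono-< : ∀ {m n} → m ℕ.< n → fromℕ m < fromℕ n
  fromℕ-mono-< {m} m<n = go (ℕ.<⇒<′ m<n)
    where
    step : ∀ n → fromℕ n < fromℕ (suc n)
    step n = <-respˡ (+-identityˡ (fromℕ n)) (+-monoˡ-< (fromℕ n) 0<1)
    go : ∀ {n} → m ℕ.<′ n → fromℕ m < fromℕ n
    go         ℕ.<′-base       = step m
    go {suc n} (ℕ.<′-step m<n) = <-trans (go m<n) (step n)

-- Vertices of a Minkowski sum of simplices and the functionals that expose them

module Vertices {c ℓ₁ ℓ₂ ℓ₃} (F : OrderedField c ℓ₁ ℓ₂ ℓ₃) (n k s : ℕ) where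
  open OrderedField F hiding (zero; setoid)
  open CommutativeRing commutativeRing using (semiring; setoid)
  open Geometry F
  open OrderedFieldProperties F
  open SemiringSum semiring
  open VectorEquality setoid using (_≋_; ≋-sym; ≋-trans; ≋-refl)
  open LinearAlgebra commutativeRing using (∑-𝟙ʳ)
  open HeytingProperties heytingCommutativeRing using (#-congˡ; #-congʳ)
  open CommutativeSemigroupProperties (CommutativeRing.*-commutativeSemigroup commutativeRing) using (x∙yz≈y∙xz)
  open ≈-Reasoning setoid

  d : ℕ
  d = s ℕ.* (n ∸ 1) ℕ.+ k

  P : Pred (Point d) _
  P = polytope n k s

  InBlock : Fin n → Fin d → Set
  InBlock i j = s ℕ.* toℕ i ℕ.≤ toℕ j × toℕ j ℕ.< s ℕ.* toℕ i ℕ.+ k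

  Generator : Fin n → Pred (Point d) _
  Generator i x = ∃[ j ] (s ℕ.* toℕ i ℕ.≤ toℕ j × toℕ j ℕ.< s ℕ.* toℕ i ℕ.+ k × x ≋ e j)

  block : Fin n → Pred (Point d) _
  block i = blockSimplex k s (toℕ i)

  ·-cong : ∀ {m} (u : Point m) {x y} → x ≋ y → u · x ≈ u · y
  ·-cong u x≋y = sum-cong-≋ λ l → *-congˡ {u l} (x≋y l)

  ·-e : ∀ {m} (u : Point m) j → u · e j ≈ u j
  ·-e u j = ∑-𝟙ʳ u j

  ·-sum : ∀ {m r} (u : Point m) (y : Fin r → Point m) → u · (λ l → sum λ i → y i l) ≈ sum λ i → u · y i
  ·-sum u y = trans
    (sum-cong-≋ λ l → *-distribˡ-sum (u l) (λ i → y i l))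
    (∑-comm λ l i → u l * y i l)

  ·-combination : ∀ {m r} (u : Point m) (w : Fin r → Carrier) (p : Fin r → Point m) →
                  u · (λ l → sum λ i → w i * p i l) ≈ sum λ i → w i * (u · p i)
  ·-combination u w p = trans (·-sum u λ i l → w i * p i l) (sum-cong-≋ λ i → begin
    sum (λ l → u l * (w i * p i l))  ≈⟨ sum-cong-≋ (λ l → x∙yz≈y∙xz (u l) (w i) (p i l)) ⟩
    sum (λ l → w i * (u l * p i l))  ≈⟨ *-distribˡ-sum (w i) (λ l → u l * p i l) ⟨
    w i * (u · p i)                  ∎)

  sum-weights : ∀ {m} (w : Fin m → Carrier) → sum w ≈ 1# → ∀ a → sum (λ i → w i * a) ≈ a
  sum-weights w Σw≈1 a = trans (sym (*-distribʳ-sum a w)) (trans (*-congʳ Σw≈1) (*-identityˡ a))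

  block-≤ : ∀ {i u M} → (∀ j → InBlock i j → u j ≤ M) → ∀ {y} → y ∈ block i → u · y ≤ M
  block-≤ {u = u} {M} u≤M {y} (m , p , w , p∈ , 0≤w , Σw≈1 , y≋) = ≤-resp
    (sym (trans (·-cong u y≋) (·-combination u w p)))
    (sum-weights w Σw≈1 M)
    (sum-mono-≤ λ r → *-monoˡ-≤ (0≤w r) (bound r))
    where
    bound : ∀ r → u · p r ≤ M
    bound r with p∈ r
    ... | j , lo , hi , pr≋ej = ≤-resp (sym (trans (·-cong u pr≋ej) (·-e u j))) refl (u≤M j (lo , hi))

  e∈block : ∀ {i j} → InBlock i j → e j ∈ block i
  e∈block {j = j} (lo , hi) =
    1 , const (e j) , const 1# , (λ _ → j , lo , hi , λ _ → refl) , (λ _ → <⇒≤ 0<1) , +-identityʳ 1# ,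
    λ l → sym (trans (+-identityʳ _) (*-identityˡ _))

  vertexAt : (Fin n → Fin d) → Point d
  vertexAt J l = sum λ i → e (J i) l

  ·-vertexAt : ∀ u J → u · vertexAt J ≈ sum (u ∘ J)
  ·-vertexAt u J = trans (·-sum u (e ∘ J)) (sum-cong-≋ λ i → ·-e u (J i))

  vertexAt∈P : ∀ {J} → (∀ i → InBlock i (J i)) → vertexAt J ∈ P
  vertexAt∈P {J} J∈ = e ∘ J , (λ i → e∈block (J∈ i)) , λ l → refl

  P-resp : ∀ {x y} → x ≋ y → y ∈ P → x ∈ P
  P-resp x≋y (Y , Y∈ , y≋) = Y , Y∈ , ≋-trans x≋y y≋

  Maximises Selects : Point d → (Fin n → Fin d) → Set _
  Maximises u J = ∀ i j → InBlock i j → u j ≤ u (J i)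
  Selects   u J = ∀ i j → InBlock i j → j ≢ J i → u j < u (J i)

  selects⇒maximises : ∀ {u J} → Selects u J → Maximises u J
  selects⇒maximises {J = J} sel i j j∈ with j ≟ J i
  ... | yes ≡.refl = ≤-reflexive refl
  ... | no  j≢Ji   = <⇒≤ (sel i j j∈ j≢Ji)

  maximises⇒≤ : ∀ {u J} → Maximises u J → ∀ y → y ∈ P → u · y ≤ u · vertexAt J
  maximises⇒≤ {u} {J} max y (Y , Y∈ , y≋) = ≤-resp
    (sym (trans (·-cong u y≋) (·-sum u Y)))
    (sym (·-vertexAt u J))
    (sum-mono-≤ λ i → block-≤ (max i) (Y∈ i))

  -- Both `y l` and `e j₀ l` are averages with the weights `w`, so if they are apart, some term is:
  -- its weight is positive and its generator is not `e j₀`, hence has strictly smaller value.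
  block-< : ∀ {i u j₀} → (∀ j → InBlock i j → j ≢ j₀ → u j < u j₀) →
            ∀ {y} → y ∈ block i → ∀ l → y l # e j₀ l → u · y < u j₀
  block-< {u = u} {j₀} sel {y} (m , p , w , p∈ , 0≤w , Σw≈1 , y≋) l yl#el
    with r , wp#we ← sum-#⇒∃# (#-congʳ (y≋ l) (#-congˡ (sym (sum-weights w Σw≈1 (e j₀ l))) yl#el))
    with w#0 , p#e ← *-#⇒# wp#we = <-resp
      (sym (trans (·-cong u y≋) (·-combination u w p)))
      (sum-weights w Σw≈1 (u j₀))
      (sum-mono-< (λ t → *-monoˡ-≤ (0≤w t) (bound t)) r (*-monoˡ-< (0≤∧#⇒0< (0≤w r) w#0) strict))
    where
    bound : ∀ t → u · p t ≤ u j₀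
    bound t with p∈ t
    ... | j , lo , hi , pt≋ej with j ≟ j₀
    ...   | yes ≡.refl = ≤-reflexive (trans (·-cong u pt≋ej) (·-e u j))
    ...   | no  j≢j₀   = <⇒≤ (<-respˡ (sym (trans (·-cong u pt≋ej) (·-e u j))) (sel j (lo , hi) j≢j₀))
    strict : u · p r < u j₀
    strict with p∈ r
    ... | j , lo , hi , pr≋ej with j ≟ j₀
    ...   | yes ≡.refl = contradiction p#e (#-irrefl (pr≋ej l))
    ...   | no  j≢j₀   = <-respˡ (sym (trans (·-cong u pr≋ej) (·-e u j))) (sel j (lo , hi) j≢j₀)

  selects⇒isVertex : ∀ {u J} → (∀ i → InBlock i (J i)) → Selects u J → IsVertex P (vertexAt J)
  selects⇒isVertex {u} {J} J∈ sel = u , λ x → mk⇔ to from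
    where
    to : ∀ {x} → x ≋ vertexAt J → x ∈ P × (∀ y → y ∈ P → u · y ≤ u · x)
    to x≋v = P-resp x≋v (vertexAt∈P J∈) , λ y y∈P →
      ≤-resp refl (sym (·-cong u x≋v)) (maximises⇒≤ (selects⇒maximises sel) y y∈P)
    from : ∀ {x} → x ∈ P × (∀ y → y ∈ P → u · y ≤ u · x) → x ≋ vertexAt J
    -- Equality is the negation of apartness, so it suffices to refute that the coordinates are
    -- apart. If they were, some summand would deviate from its selected vertex and `x` would not be
    -- maximal.
    from {x} ((Y , Y∈ , x≋) , max) l = proj₁ (tight _ _) λ xl#vl →
      let i , Yil#el = sum-#⇒∃# (#-congʳ (x≋ l) xl#vl) in
      max (vertexAt J) (vertexAt∈P J∈) (<-resp
        (sym (trans (·-cong u x≋) (·-sum u Y)))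
        (sym (·-vertexAt u J))
        (sum-mono-< (λ i → block-≤ (selects⇒maximises sel i) (Y∈ i)) i
          (block-< (sel i) (Y∈ i) l Yil#el)))

  selects-injective : ∀ {u J J′} → Selects u J → (∀ i → InBlock i (J′ i)) → vertexAt J′ ≋ vertexAt J → ∀ i → J′ i ≡ J i
  selects-injective {u} {J} {J′} sel J′∈ v′≋v i with J′ i ≟ J i
  ... | yes eq = eq
  ... | no  ≢  = contradiction
    (sum-mono-< (λ i → selects⇒maximises sel i (J′ i) (J′∈ i)) i (sel i (J′ i) (J′∈ i) ≢))
    (<-irrefl (trans (sym (·-vertexAt u J′)) (trans (·-cong u v′≋v) (·-vertexAt u J))))

  -- A point of a simplex has a positive weight at some e j, and whatever
  -- functional the point maximises, e j maximises too: otherwise moving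
  -- that weight to a better basis vector would improve the point.
  support : ∀ {i y} → y ∈ block i → ∃[ j ] InBlock i j ×
            (∀ u → (∀ z → z ∈ block i → u · z ≤ u · y) → ∀ j′ → InBlock i j′ → u j′ ≤ u j)
  support {i} {y} (m , p , w , p∈ , 0≤w , Σw≈1 , y≋)
    with r , 0<wr ← sum-<⇒∃< (<-resp (sym (sum-replicate-zero m)) (sym Σw≈1) 0<1)
    with j , lo , hi , pr≋ej ← p∈ r in eq =
    j , (lo , hi) , λ u max j′ j′∈ uj<uj′ →
      let p′ = updateAt p r (const (e j′))
          y′ = λ l → sum λ t → w t * p′ t l
      in max y′
        (m , p′ , w , updateAt-all (λ _ → Generator i) p r (e j′) p∈ (j′ , proj₁ j′∈ , proj₂ j′∈ , λ _ → refl) , 0≤w , Σw≈1 , λ _ → refl)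
        (<-resp (sym (trans (·-cong u y≋) (·-combination u w p))) (sym (·-combination u w p′))
          (sum-mono-<
            (λ t → *-monoˡ-≤ (0≤w t)
              (updateAt-all (λ t x → u · p t ≤ u · x) p r (e j′) (λ _ → ≤-reflexive refl)
                (<⇒≤ (improves u uj<uj′)) t))
            r
            (*-monoˡ-< 0<wr (≡.subst (λ x → u · p r < u · x) (≡.sym (updateAt-updates r p)) (improves u uj<uj′)))))
    where
    improves : ∀ u {j′} → u j < u j′ → u · p r < u · e j′
    improves u {j′} = <-resp (sym (trans (·-cong u pr≋ej) (·-e u j))) (sym (·-e u j′))

  e-same : ∀ {m} (j : Fin m) → e j j ≈ 1#
  e-same j = reflexive (≡.cong (λ b → if b then 1# else 0#) (dec-true (j ≟ j) ≡.refl))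

  e-distinct : ∀ {m} {i j : Fin m} → i ≢ j → e i j ≈ 0#
  e-distinct {i = i} {j} i≢j = reflexive (≡.cong (λ b → if b then 1# else 0#) (dec-false (i ≟ j) i≢j))

  -- A maximiser of a Minkowski sum is maximal in each summand, so the supports of the summands of
  -- `v` give a maximising choice; its point lies in the face and is therefore `v`.
  isVertex⇒selects : ∀ {v} → IsVertex P v → ∃[ u ] ∃[ J ]
    (∀ i → InBlock i (J i)) × vertexAt J ≋ v ×
    (∀ i j → InBlock i j → j ≢ J i → ¬ ¬ u j < u (J i))
  isVertex⇒selects {v} (u , face)
    with (Y , Y∈ , v≋) , v-max ← Equivalence.to (face v) ≋-refl =
    u , J , J∈ , vJ≋v , strict
    where
    Y-max : ∀ i z → z ∈ block i → u · z ≤ u · Y i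
    Y-max i z z∈ uYi<uz = v-max (λ l → sum λ i → Y′ i l)
      (Y′ , updateAt-all (λ i x → x ∈ block i) Y i z Y∈ z∈ , λ _ → refl)
      (<-resp (sym (trans (·-cong u v≋) (·-sum u Y))) (sym (·-sum u Y′))
        (sum-mono-<
          (updateAt-all (λ i x → u · Y i ≤ u · x) Y i z (λ _ → ≤-reflexive refl) (<⇒≤ uYi<uz))
          i
          (≡.subst (λ x → u · Y i < u · x) (≡.sym (updateAt-updates i Y)) uYi<uz)))
      where Y′ = updateAt Y i (const z)
    J : Fin n → Fin d
    J i = proj₁ (support (Y∈ i))
    J∈ : ∀ i → InBlock i (J i)
    J∈ i = proj₁ (proj₂ (support (Y∈ i)))
    J-max : Maximises u J
    J-max i = proj₂ (proj₂ (support (Y∈ i))) u (Y-max i)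
    maximiser : ∀ {J} → (∀ i → InBlock i (J i)) → Maximises u J → vertexAt J ≋ v
    maximiser J∈ max = Equivalence.from (face _) (vertexAt∈P J∈ , maximises⇒≤ max)
    vJ≋v : vertexAt J ≋ v
    vJ≋v = maximiser J∈ J-max
    strict : ∀ i j → InBlock i j → j ≢ J i → ¬ ¬ u j < u (J i)
    -- The assumption `¬ u j < u (J i)` is literally `u (J i) ≤ u j`, so `j` may replace `J i`
    -- without loss. Both choices then give `v`, yet coordinate `j` grows by one.
    strict i j j∈ j≢Ji uJi≤uj = <-irrefl
      (≋-trans vJ≋v (≋-sym (maximiser
        (updateAt-all InBlock J i j J∈ j∈)
        (updateAt-all (λ i j → ∀ j′ → InBlock i j′ → u j′ ≤ u j) J i j J-max
          (λ j′ j′∈ → ≤-trans (J-max i j′ j′∈) uJi≤uj)))) j)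
      (sum-mono-<
        (updateAt-all (λ i x → e (J i) j ≤ e x j) J i j (λ _ → ≤-reflexive refl) (<⇒≤ 0<1′))
        i
        (≡.subst (λ x → e (J i) j < e x j) (≡.sym (updateAt-updates i J)) 0<1′))
      where
      0<1′ : e (J i) j < e j j
      0<1′ = <-resp (sym (e-distinct (j≢Ji ∘ ≡.sym))) (sym (e-same j)) 0<1

-- Enumeration of the walks in a digraph and their count by matrix powers

linked-tabulate : ∀ {a ℓ} {A : Set a} {R : Rel A ℓ} n (f : Fin (suc n) → A) →
                  (∀ i → R (f (inject₁ i)) (f (suc i))) → Linked R (Vec.tabulate f)
linked-tabulate zero    f Rf = [-]
linked-tabulate (suc n) f Rf = Rf zero ∷ linked-tabulate n (f ∘ suc) (Rf ∘ suc)

unique-lookup-injective : ∀ {a} {A : Set a} {xs : List A} → Unique xs →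
                          ∀ i j → List.lookup xs i ≡ List.lookup xs j → i ≡ j
unique-lookup-injective (x∉xs ∷ xs!) zero    zero    eq = ≡.refl
unique-lookup-injective (x∉xs ∷ xs!) zero    (suc j) eq = contradiction eq (All.lookup x∉xs (∈-lookup j))
unique-lookup-injective (x∉xs ∷ xs!) (suc i) zero    eq = contradiction (≡.sym eq) (All.lookup x∉xs (∈-lookup i))
unique-lookup-injective (x∉xs ∷ xs!) (suc i) (suc j) eq = ≡.cong suc (unique-lookup-injective xs! i j eq)

module Walks {k : ℕ} {R : Rel (Fin k) 0ℓ} (R? : Decidable R) where
  open ℤSeries using (module Σℤ; module Lℤ)
  open Σℤ using (sum; sum-cong-≋; ∑-comm; *-distribˡ-sum)

  -- Grown at the front, as `_^ᴹ_` multiplies on the left, so that the lengths obey the recursion of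
  -- the row sums of the powers.
  walksFrom : ∀ n → Fin k → List (Vec (Fin k) (suc n))
  successors : ∀ n → Fin k → Fin k → List (Vec (Fin k) (suc n))
  walksFrom zero    x = List.[ Vec.[ x ] ]
  walksFrom (suc n) x = List.map (x ∷_) (List.concat (List.tabulate (successors n x)))
  successors n x y = if does (R? x y) then walksFrom n y else []

  walks : ∀ n → List (Vec (Fin k) (suc n))
  walks n = List.concat (List.tabulate (walksFrom n))

  ∈-successors⁺ : ∀ n {x y w} → R x y → w ∈ˡ walksFrom n y → w ∈ˡ successors n x y
  ∈-successors⁺ n {x} {y} Rxy w∈ with R? x y
  ... | yes _   = w∈
  ... | no ¬Rxy = contradiction Rxy ¬Rxy

  ∈-successors⁻ : ∀ n {x y w} → w ∈ˡ successors n x y → R x y × w ∈ˡ walksFrom n y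
  ∈-successors⁻ n {x} {y} w∈ with R? x y
  ... | yes Rxy = Rxy , w∈
  ∈-successors⁻ n {x} {y} () | no _

  ∈-concat-tabulate⁻ : ∀ {m} {A : Set} {v : A} (f : Fin m → List A) →
                       v ∈ˡ List.concat (List.tabulate f) → ∃[ i ] v ∈ˡ f i
  ∈-concat-tabulate⁻ f v∈ with ∈-concat⁻′ (List.tabulate f) v∈
  ... | xs , v∈xs , xs∈ with ∈-tabulate⁻ xs∈
  ...   | i , ≡.refl = i , v∈xs

  ∈-concat-tabulate⁺ : ∀ {m} {A : Set} {v : A} (f : Fin m → List A) i →
                       v ∈ˡ f i → v ∈ˡ List.concat (List.tabulate f)
  ∈-concat-tabulate⁺ f i v∈ = ∈-concat⁺′ v∈ (∈-tabulate⁺ i)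

  ∈-walksFrom⁺ : ∀ {n} {w : Vec (Fin k) (suc n)} → Linked R w → w ∈ˡ walksFrom n (head w)
  ∈-walksFrom⁺ [-] = here ≡.refl
  ∈-walksFrom⁺ {suc n} {x ∷ w} (Rx ∷ Rw) = ∈-map⁺ (x ∷_)
    (∈-concat-tabulate⁺ (successors n x) (head w) (∈-successors⁺ n Rx (∈-walksFrom⁺ Rw)))

  ∈-walksFrom⁻ : ∀ n {x w} → w ∈ˡ walksFrom n x → head w ≡ x × Linked R w
  ∈-walksFrom⁻ zero    (here ≡.refl) = ≡.refl , [-]
  ∈-walksFrom⁻ (suc n) {x} w∈ with ∈-map⁻ (x ∷_) w∈
  ... | w , w∈ , ≡.refl with ∈-concat-tabulate⁻ (successors n x) w∈
  ...   | y , w∈ with ∈-successors⁻ n w∈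
  ...     | Rxy , w∈ with ∈-walksFrom⁻ n w∈
  ...       | ≡.refl , Rw = ≡.refl , Rxy ∷ Rw

  -- Lists for different `y` are disjoint, because the head of a walk reveals `y`.
  unique-concat-tabulate : ∀ {n} (f : Fin k → List (Vec (Fin k) (suc n))) →
    (∀ y → Unique (f y)) → (∀ {y w} → w ∈ˡ f y → head w ≡ y) → Unique (List.concat (List.tabulate f))
  unique-concat-tabulate f f! head-f = Unique.concat⁺ (All.tabulate⁺ f!)
    (AllPairs.tabulate⁺ λ i≢j (w∈fi , w∈fj) → i≢j (≡.trans (≡.sym (head-f w∈fi)) (head-f w∈fj)))

  unique-walksFrom : ∀ n x → Unique (walksFrom n x)
  unique-walksFrom zero    x = All.[] ∷ []
  unique-walksFrom (suc n) x = Unique.map⁺ Vec.∷-injectiveʳ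
    (unique-concat-tabulate (successors n x) successors! λ w∈ → proj₁ (∈-walksFrom⁻ n (proj₂ (∈-successors⁻ n w∈))))
    where
    successors! : ∀ y → Unique (successors n x y)
    successors! y with R? x y
    ... | yes _ = unique-walksFrom n y
    ... | no  _ = []

  unique-walks : ∀ n → Unique (walks n)
  unique-walks n = unique-concat-tabulate (walksFrom n) (unique-walksFrom n) λ w∈ → proj₁ (∈-walksFrom⁻ n w∈)

  ∈-walks⁺ : ∀ {n} {w : Vec (Fin k) (suc n)} → Linked R w → w ∈ˡ walks n
  ∈-walks⁺ {n} {w} Rw = ∈-concat-tabulate⁺ (walksFrom n) (head w) (∈-walksFrom⁺ Rw)

  ∈-walks⁻ : ∀ {n} {w : Vec (Fin k) (suc n)} → w ∈ˡ walks n → Linked R w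
  ∈-walks⁻ {n} w∈ = proj₂ (∈-walksFrom⁻ n (proj₂ (∈-concat-tabulate⁻ (walksFrom n) w∈)))

  A : ℤMatrix k
  A x y = if does (R? x y) then 1ℤ else 0ℤ

  length-concat-tabulate : ∀ {m} {B : Set} (f : Fin m → List B) →
    + List.length (List.concat (List.tabulate f)) ≡ sum λ i → + List.length (f i)
  length-concat-tabulate {zero}  f = ≡.refl
  length-concat-tabulate {suc m} f = ≡.trans
    (≡.cong +_ (List.length-++ (f zero)))
    (≡.cong (λ z → + List.length (f zero) ℤ.+ z) (length-concat-tabulate (f ∘ suc)))

  length-walksFrom : ∀ n x → + List.length (walksFrom n x) ≡ sum λ y → (A ^ᴹ n) x y
  length-walksFrom zero x = ≡.sym (≡.trans
    (sum-cong-≋ λ y → ≡.sym (ℤ.*-identityˡ (Matrices.𝟙 ℤ.+-*-rawRing x y)))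
    (Lℤ.∑-𝟙ʳ (const 1ℤ) x))
  length-walksFrom (suc n) x = begin
    + List.length (walksFrom (suc n) x)
      ≡⟨ ≡.cong +_ (List.length-map (x ∷_) (List.concat (List.tabulate (successors n x)))) ⟩
    + List.length (List.concat (List.tabulate (successors n x)))
      ≡⟨ length-concat-tabulate (successors n x) ⟩
    sum (λ y → + List.length (successors n x y))
      ≡⟨ sum-cong-≋ length-successors ⟩
    sum (λ y → A x y ℤ.* + List.length (walksFrom n y))
      ≡⟨ sum-cong-≋ (λ y → ≡.cong (A x y ℤ.*_) (length-walksFrom n y)) ⟩
    sum (λ y → A x y ℤ.* sum (λ z → (A ^ᴹ n) y z))
      ≡⟨ sum-cong-≋ (λ y → *-distribˡ-sum (A x y) (λ z → (A ^ᴹ n) y z)) ⟩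
    sum (λ y → sum λ z → A x y ℤ.* (A ^ᴹ n) y z)
      ≡⟨ ∑-comm (λ y z → A x y ℤ.* (A ^ᴹ n) y z) ⟩
    sum (λ z → (A ^ᴹ suc n) x z) ∎
    where
    open ≡.≡-Reasoning
    length-successors : ∀ y → + List.length (successors n x y) ≡ A x y ℤ.* + List.length (walksFrom n y)
    length-successors y with does (R? x y)
    ... | true  = ≡.sym (ℤ.*-identityˡ (+ List.length (walksFrom n y)))
    ... | false = ≡.sym (ℤ.*-zeroˡ (+ List.length (walksFrom n y)))

  length-walks : ∀ n → + List.length (walks n) ≡ entrySum (A ^ᴹ n)
  length-walks n = ≡.trans (length-concat-tabulate (walksFrom n)) (sum-cong-≋ (length-walksFrom n))

-- Natural-valued functionals selecting a given walk

open import Data.Nat.Base using (_≤_; _<_)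

module Functionals (k s : ℕ) where
  open import Data.Nat.Base using (_+_; _*_)

  position : ∀ {n} → Vec (Fin k) n → Fin n → ℕ
  position w i = s * toℕ i + toℕ (lookup w i)

  -- The functional lives on all of `ℕ`: prepending a block is then a mere shift by `s`, although
  -- the dimension of the polytope grows.
  Selecting : ∀ {n} → Vec (Fin k) n → (ℕ → ℕ) → Set
  Selecting w u = ∀ i p → s * toℕ i ≤ p → p < s * toℕ i + k → p ≢ position w i → u p < u (position w i)

  -- Measured from the start of the first block, the next choice sits at `s + toℕ y` and the overlap
  -- of the two blocks is the interval from `s` to `k - 1`. Either one of the choices is outside the
  -- overlap or they agree.
  arc-cases : ∀ {x y} → Arc k s x y → toℕ x < s ⊎ toℕ x ≡ s + toℕ y ⊎ k ≤ s + toℕ y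
  arc-cases {x} {y} arc with ℕ.<-≤-connex (toℕ x) s
  ... | inj₁ x<s = inj₁ x<s
  ... | inj₂ s≤x with ℕ.<-≤-connex (s + toℕ y) k
  ...   | inj₂ k≤s+y = inj₂ (inj₂ k≤s+y)
  ...   | inj₁ s+y<k with toℕ x ℕ.≟ s + toℕ y
  ...     | yes x≡s+y = inj₂ (inj₁ x≡s+y)
  ...     | no  x≢s+y = contradiction
    (fromℕ< x∸s< , fromℕ< y< ,
      (λ eq → x≢s+y (≡.trans x≡ (≡.cong (_+_ s) (≡.trans (≡.cong toℕ eq) (toℕ-fromℕ< y<))))) ,
      x≡ , ≡.sym (toℕ-fromℕ< y<))
    arc
    where
    x∸s< : toℕ x ∸ s < k ∸ s
    x∸s< = ℕ.∸-monoˡ-< (toℕ<n x) s≤x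
    y< : toℕ y < k ∸ s
    y< = ≡.subst (_< k ∸ s) (ℕ.m+n∸m≡n s (toℕ y)) (ℕ.∸-monoˡ-< s+y<k (ℕ.m≤m+n s (toℕ y)))
    x≡ : toℕ x ≡ s + toℕ (fromℕ< x∸s<)
    x≡ = ≡.sym (≡.trans (≡.cong (_+_ s) (toℕ-fromℕ< x∸s<)) (ℕ.m+[n∸m]≡n s≤x))

  -- Chosen coordinates never move backwards along a walk: the current choice precedes the next
  -- block, equals the next choice, or lies in a block that the next choice has left.
  arc⇒≤ : ∀ {x y} → Arc k s x y → toℕ x ≤ s + toℕ y
  arc⇒≤ {x} {y} arc with arc-cases arc
  ... | inj₁ x<s           = ℕ.≤-trans (ℕ.<⇒≤ x<s) (ℕ.m≤m+n s (toℕ y))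
  ... | inj₂ (inj₁ x≡s+y)  = ℕ.≤-reflexive x≡s+y
  ... | inj₂ (inj₂ k≤s+y)  = ℕ.≤-trans (ℕ.<⇒≤ (toℕ<n x)) k≤s+y

  position-zero : ∀ {n} x (w : Vec (Fin k) n) → position (x ∷ w) zero ≡ toℕ x
  position-zero x w = ≡.cong (_+ toℕ x) (ℕ.*-zeroʳ s)

  position-suc : ∀ {n} x (w : Vec (Fin k) n) i → position (x ∷ w) (suc i) ≡ s + position w i
  position-suc x w i = ≡.trans (≡.cong (_+ toℕ (lookup w i)) (ℕ.*-suc s (toℕ i))) (ℕ.+-assoc s _ _)

  head≤position : ∀ {n} {w : Vec (Fin k) (suc n)} → Linked (Arc k s) w → ∀ i → toℕ (head w) ≤ position w i
  head≤position {w = x ∷ w} _ zero = ℕ.≤-reflexive (≡.sym (position-zero x w))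
  head≤position {w = x ∷ w} (arc ∷ arcs) (suc i) = begin
    toℕ x                   ≤⟨ arc⇒≤ arc ⟩
    s + toℕ (head w)        ≤⟨ ℕ.+-monoʳ-≤ s (head≤position arcs i) ⟩
    s + position w i        ≡⟨ position-suc x w i ⟨
    position (x ∷ w) (suc i) ∎
    where open ℕ.≤-Reasoning

  selecting-[-] : ∀ x u → (∀ p → p < k → p ≢ toℕ x → u p < u (toℕ x)) → Selecting (x ∷ []) u
  selecting-[-] x u sel zero p _ p< p≢ rewrite ℕ.*-zeroʳ s = sel p p< p≢

  -- Old comparisons must survive only against winners `q` not below the old head, which by
  -- `head≤position` covers every chosen coordinate. This leaves room to flatten the values before
  -- the head.
  selecting-∷ : ∀ {n} x (w : Vec (Fin k) (suc n)) u₀ u → Linked (Arc k s) w → Selecting w u₀ →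
    (∀ p → p < k → p ≢ toℕ x → u p < u (toℕ x)) →
    (∀ p q → toℕ (head w) ≤ q → u₀ p < u₀ q → u (s + p) < u (s + q)) →
    Selecting (x ∷ w) u
  selecting-∷ x w u₀ u arcs sel₀ sel mono zero p _ p< p≢ rewrite ℕ.*-zeroʳ s = sel p p< p≢
  selecting-∷ x w u₀ u arcs sel₀ sel mono (suc i) p lo hi p≢
    rewrite position-suc x w i | ℕ.*-suc s (toℕ i) | ℕ.+-assoc s (s * toℕ i) k
    with ℕ.m≤n⇒∃[o]m+o≡n (ℕ.m+n≤o⇒m≤o s lo)
  ... | p′ , ≡.refl = mono p′ (position w i) (head≤position arcs i)
    (sel₀ i p′ (ℕ.+-cancelˡ-≤ s _ _ lo) (ℕ.+-cancelˡ-< s _ _ hi) (p≢ ∘ ≡.cong (_+_ s)))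

  peak : ℕ → ℕ → ℕ → ℕ
  peak x a p = if does (p ℕ.≟ x) then a else 0

  peak-same : ∀ x a → peak x a x ≡ a
  peak-same x a = ≡.cong (if_then a else 0) (dec-true (x ℕ.≟ x) ≡.refl)

  peak-other : ∀ {x p} a → p ≢ x → peak x a p ≡ 0
  peak-other {x} {p} a p≢x = ≡.cong (if_then a else 0) (dec-false (p ℕ.≟ x) p≢x)

  peak-≤ : ∀ x a p → peak x a p ≤ a
  peak-≤ x a p with does (p ℕ.≟ x)
  ... | true  = ℕ.≤-refl
  ... | false = z≤n

  -- The cut `b` is `s` when only the coordinates preceding the old blocks get new values, and `k`
  -- when the whole new block is overridden. Raising `g` above the old functional by 1 or 2 frees
  -- the lowest values for `f`.
  splice : ℕ → (ℕ → ℕ) → (ℕ → ℕ) → ℕ → ℕ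
  splice b f g p = if does (p ℕ.<? b) then f p else g (p ∸ s)

  splice-< : ∀ {b p} f g → p < b → splice b f g p ≡ f p
  splice-< {b} {p} f g p<b = ≡.cong (if_then f p else g (p ∸ s)) (dec-true (p ℕ.<? b) p<b)

  splice-≥ : ∀ {b p} f g → b ≤ s + p → splice b f g (s + p) ≡ g p
  splice-≥ {b} {p} f g b≤ = ≡.trans
    (≡.cong (if_then f (s + p) else g (s + p ∸ s)) (dec-false (s + p ℕ.<? b) (ℕ.≤⇒≯ b≤)))
    (≡.cong g (ℕ.m+n∸m≡n s p))

  splice-bounded : ∀ b f g {M} → (∀ p → f p < M) → (∀ p → g p < M) → ∀ p → splice b f g p < M
  splice-bounded b f g f<M g<M p with does (p ℕ.<? b)
  ... | true  = f<M p
  ... | false = g<M (p ∸ s)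

  -- The functional is built by prepending blocks.  A value at x < s lies in
  -- the new block only and may be made larger than all old values; if x
  -- repeats the old head, the old values already decide; otherwise the old
  -- walk stays outside the new block, whose values may all be made smaller
  -- than the old ones.
  selecting : ∀ {n} (w : Vec (Fin k) (suc n)) → Linked (Arc k s) w →
              ∃[ u ] (∃[ M ] (∀ p → u p < M)) × Selecting w u
  selecting (x ∷ []) _ =
    peak (toℕ x) 1 , (2 , λ p → s≤s (peak-≤ (toℕ x) 1 p)) , selecting-[-] x _ λ p _ p≢x →
      ≡.subst₂ _<_ (≡.sym (peak-other 1 p≢x)) (≡.sym (peak-same (toℕ x) 1)) ℕ.z<s
  selecting (x ∷ w@(y ∷ _)) (arc ∷ arcs) with selecting w arcs
  ... | u₀ , (M , u₀<M) , sel₀ with arc-cases arc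
  ...   | inj₁ x<s = u , (suc M , splice-bounded s f u₀ (s≤s ∘ peak-≤ (toℕ x) M) (ℕ.m<n⇒m<1+n ∘ u₀<M)) ,
    selecting-∷ x w u₀ u arcs sel₀ new old
    where
    f = peak (toℕ x) M
    u = splice s f u₀
    u-x : u (toℕ x) ≡ M
    u-x = ≡.trans (splice-< f u₀ x<s) (peak-same (toℕ x) M)
    new : ∀ p → p < k → p ≢ toℕ x → u p < u (toℕ x)
    new p _ p≢x with ℕ.<-≤-connex p s
    ... | inj₁ p<s = ≡.subst₂ _<_ (≡.sym (≡.trans (splice-< f u₀ p<s) (peak-other M p≢x))) (≡.sym u-x)
      (ℕ.≤-<-trans z≤n (u₀<M 0))
    ... | inj₂ s≤p with ℕ.m≤n⇒∃[o]m+o≡n s≤p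
    ...   | p′ , ≡.refl = ≡.subst₂ _<_ (≡.sym (splice-≥ f u₀ s≤p)) (≡.sym u-x) (u₀<M p′)
    old : ∀ p q → toℕ y ≤ q → u₀ p < u₀ q → u (s + p) < u (s + q)
    old p q _ = ≡.subst₂ _<_ (≡.sym (splice-≥ f u₀ (ℕ.m≤m+n s p))) (≡.sym (splice-≥ f u₀ (ℕ.m≤m+n s q)))
  ...   | inj₂ (inj₁ x≡s+y) = u , (suc M , splice-bounded s (const 0) (suc ∘ u₀) (const ℕ.z<s) (s≤s ∘ u₀<M)) ,
    selecting-∷ x w u₀ u arcs sel₀ new old
    where
    u = splice s (const 0) (suc ∘ u₀)
    u-+ : ∀ p → u (s + p) ≡ suc (u₀ p)
    u-+ p = splice-≥ (const 0) (suc ∘ u₀) (ℕ.m≤m+n s p)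
    u-x : u (toℕ x) ≡ suc (u₀ (toℕ y))
    u-x = ≡.trans (≡.cong u x≡s+y) (u-+ (toℕ y))
    sel-y : ∀ p → p < k → p ≢ toℕ y → u₀ p < u₀ (toℕ y)
    sel-y p p<k p≢y with sel₀ zero p
    ... | sel-p rewrite ℕ.*-zeroʳ s = sel-p z≤n p<k p≢y
    new : ∀ p → p < k → p ≢ toℕ x → u p < u (toℕ x)
    new p p<k p≢x with ℕ.<-≤-connex p s
    ... | inj₁ p<s = ≡.subst₂ _<_ (≡.sym (splice-< (const 0) (suc ∘ u₀) p<s)) (≡.sym u-x) ℕ.z<s
    ... | inj₂ s≤p with ℕ.m≤n⇒∃[o]m+o≡n s≤p
    ...   | p′ , ≡.refl = ≡.subst₂ _<_ (≡.sym (u-+ p′)) (≡.sym u-x) (s≤s (sel-y p′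
      (ℕ.≤-<-trans (ℕ.m≤n+m p′ s) p<k) λ p′≡y → p≢x (≡.trans (≡.cong (_+_ s) p′≡y) (≡.sym x≡s+y))))
    old : ∀ p q → toℕ y ≤ q → u₀ p < u₀ q → u (s + p) < u (s + q)
    old p q _ u₀< = ≡.subst₂ _<_ (≡.sym (u-+ p)) (≡.sym (u-+ q)) (s≤s u₀<)
  ...   | inj₂ (inj₂ k≤s+y) = u , (2 + M , splice-bounded k f g
        (λ p → s≤s (ℕ.≤-trans (peak-≤ (toℕ x) 1 p) (s≤s z≤n))) (s≤s ∘ s≤s ∘ u₀<M)) ,
    selecting-∷ x w u₀ u arcs sel₀ new old
    where
    f = peak (toℕ x) 1
    g = λ p → 2 + u₀ p
    u = splice k f g
    new : ∀ p → p < k → p ≢ toℕ x → u p < u (toℕ x)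
    new p p<k p≢x = ≡.subst₂ _<_
      (≡.sym (≡.trans (splice-< f g p<k) (peak-other 1 p≢x)))
      (≡.sym (≡.trans (splice-< f g (toℕ<n x)) (peak-same (toℕ x) 1)))
      ℕ.z<s
    old : ∀ p q → toℕ y ≤ q → u₀ p < u₀ q → u (s + p) < u (s + q)
    old p q y≤q u₀< = ≡.subst (u (s + p) <_)
      (≡.sym (splice-≥ f g (ℕ.≤-trans k≤s+y (ℕ.+-monoʳ-≤ s y≤q)))) small
      where
      small : u (s + p) < 2 + u₀ q
      small with ℕ.<-≤-connex (s + p) k
      ... | inj₁ <k = ≡.subst (_< 2 + u₀ q) (≡.sym (splice-< f g <k))
        (s≤s (ℕ.≤-trans (peak-≤ (toℕ x) 1 (s + p)) (s≤s z≤n)))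
      ... | inj₂ k≤ = ≡.subst (_< 2 + u₀ q) (≡.sym (splice-≥ f g k≤)) (s≤s (s≤s u₀<))

-- The bijection between walks and vertices

module WalkVertices {c ℓ₁ ℓ₂ ℓ₃} (F : OrderedField c ℓ₁ ℓ₂ ℓ₃) (k s n : ℕ) where
  open OrderedField F using (commutativeRing) renaming (_<_ to _<ᶠ_)
  open Geometry F using (Point; IsVertex; HasVertexCount; e)
  open OrderedFieldProperties F using (fromℕ; fromℕ-mono-<; <⇒≤)
  open Vertices F (suc n) k s
  open Functionals k s
  open Walks (arc? k s)
  open CommutativeRing commutativeRing using (reflexive; trans; semiring)
  open SemiringSum semiring using (sum-cong-≋)
  open VectorEquality (CommutativeRing.setoid commutativeRing) using (_≋_)

  Walk : Set
  Walk = Vec (Fin k) (suc n)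

  position-< : ∀ (w : Walk) i → position w i < d
  position-< w i = ℕ.+-mono-≤-< (ℕ.*-monoʳ-≤ s (toℕ≤pred[n] i)) (toℕ<n (lookup w i))

  choice : Walk → Fin (suc n) → Fin d
  choice w i = fromℕ< (position-< w i)

  toℕ-choice : ∀ w i → toℕ (choice w i) ≡ position w i
  toℕ-choice w i = toℕ-fromℕ< (position-< w i)

  choice∈ : ∀ w i → InBlock i (choice w i)
  choice∈ w i rewrite toℕ-choice w i = ℕ.m≤m+n _ _ , ℕ.+-monoʳ-< (s ℕ.* toℕ i) (toℕ<n (lookup w i))

  choice-injective : ∀ {w w′} → (∀ i → choice w i ≡ choice w′ i) → w ≡ w′
  choice-injective {w} {w′} eq = ≡.trans (≡.sym (Vec.tabulate∘lookup w)) (≡.trans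
    (Vec.tabulate-cong λ i → toℕ-injective (ℕ.+-cancelˡ-≡ (s ℕ.* toℕ i) _ _
      (≡.trans (≡.sym (toℕ-choice w i)) (≡.trans (≡.cong toℕ (eq i)) (toℕ-choice w′ i)))))
    (Vec.tabulate∘lookup w′))

  functional : ∀ {w} → Linked (Arc k s) w → ∃[ u ] Selects u (choice w)
  functional {w} arcs with selecting w arcs
  ... | u , _ , sel = fromℕ ∘ u ∘ toℕ , λ i j (lo , hi) j≢ → fromℕ-mono-<
    (≡.subst (λ p → u (toℕ j) < u p) (≡.sym (toℕ-choice w i))
      (sel i (toℕ j) lo hi λ eq → j≢ (toℕ-injective (≡.trans eq (≡.sym (toℕ-choice w i))))))

  walk-isVertex : ∀ {w} → Linked (Arc k s) w → IsVertex P (vertexAt (choice w))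
  walk-isVertex {w} arcs = selects⇒isVertex (choice∈ w) (proj₂ (functional arcs))

  selects⇒walk : ∀ {u : Point d} {J : Fin (suc n) → Fin d} → (∀ i → InBlock i (J i)) →
                 (∀ i j → InBlock i j → j ≢ J i → ¬ ¬ u j <ᶠ u (J i)) →
                 ∃[ w ] Linked (Arc k s) w × (∀ i → choice w i ≡ J i)
  selects⇒walk {u} {J} J∈ strict = Vec.tabulate offset , linked-tabulate n offset arc , choice≡J
    where
    offset< : ∀ i → toℕ (J i) ∸ s ℕ.* toℕ i < k
    offset< i = ≡.subst (toℕ (J i) ∸ s ℕ.* toℕ i <_) (ℕ.m+n∸m≡n (s ℕ.* toℕ i) k)
      (ℕ.∸-monoˡ-< (proj₂ (J∈ i)) (proj₁ (J∈ i)))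
    offset : Fin (suc n) → Fin k
    offset i = fromℕ< (offset< i)
    J≡ : ∀ i → s ℕ.* toℕ i ℕ.+ toℕ (offset i) ≡ toℕ (J i)
    J≡ i = ≡.trans (≡.cong (ℕ._+_ (s ℕ.* toℕ i)) (toℕ-fromℕ< (offset< i))) (ℕ.m+[n∸m]≡n (proj₁ (J∈ i)))
    choice≡J : ∀ i → choice (Vec.tabulate offset) i ≡ J i
    choice≡J i = toℕ-injective (≡.trans (toℕ-choice (Vec.tabulate offset) i) (≡.trans
      (≡.cong (λ x → s ℕ.* toℕ i ℕ.+ toℕ x) (Vec.lookup∘tabulate offset i)) (J≡ i)))
    arc : ∀ i → Arc k s (offset (inject₁ i)) (offset (suc i))
    arc i (i′ , j′ , i′≢j′ , x≡ , y≡) =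
      -- An excluded arc puts two distinct choices into the overlap, so each block would have to
      -- rank its own choice strictly above the other's. The goal is a contradiction, which lets
      -- both double negations be opened.
      strict (suc i) (J a) a∈ a≢b λ ua<ub → strict a (J (suc i)) b∈ (a≢b ∘ ≡.sym) (<⇒≤ ua<ub)
      where
      a = inject₁ i
      t = s ℕ.* toℕ i
      Ja≡ : toℕ (J a) ≡ t ℕ.+ (s ℕ.+ toℕ i′)
      Ja≡ = ≡.trans (≡.sym (J≡ a)) (≡.cong₂ ℕ._+_ (≡.cong (s ℕ.*_) (toℕ-inject₁ i)) x≡)
      s*suc : s ℕ.* suc (toℕ i) ≡ t ℕ.+ s
      s*suc = ≡.trans (ℕ.*-suc s (toℕ i)) (ℕ.+-comm s t)
      Jb≡ : toℕ (J (suc i)) ≡ t ℕ.+ (s ℕ.+ toℕ j′)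
      Jb≡ = ≡.trans (≡.sym (J≡ (suc i))) (≡.trans (≡.cong₂ ℕ._+_ s*suc y≡) (ℕ.+-assoc t s (toℕ j′)))
      s+< : ∀ (j : Fin (k ∸ s)) → s ℕ.+ toℕ j < k
      s+< j = ℕ.≰⇒> (ℕ.<⇒≱ (toℕ<n j) ∘ ℕ.m≤n+o⇒m∸n≤o k s)
      a≢b : J a ≢ J (suc i)
      a≢b eq = i′≢j′ (toℕ-injective (ℕ.+-cancelˡ-≡ s _ _ (ℕ.+-cancelˡ-≡ t _ _
        (≡.trans (≡.sym Ja≡) (≡.trans (≡.cong toℕ eq) Jb≡)))))
      a∈ : InBlock (suc i) (J a)
      a∈ = ≡.subst₂ _≤_ (≡.sym s*suc) (≡.sym Ja≡) (ℕ.+-monoʳ-≤ t (ℕ.m≤m+n s (toℕ i′))) ,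
        ≡.subst₂ _<_ (≡.sym Ja≡) (≡.cong (ℕ._+ k) (≡.sym s*suc))
          (ℕ.+-mono-≤-< (ℕ.m≤m+n t s) (s+< i′))
      b∈ : InBlock a (J (suc i))
      b∈ = ≡.subst₂ _≤_ (≡.cong (s ℕ.*_) (≡.sym (toℕ-inject₁ i))) (≡.sym Jb≡) (ℕ.m≤m+n t _) ,
        ≡.subst₂ _<_ (≡.sym Jb≡) (≡.cong (λ m → s ℕ.* m ℕ.+ k) (≡.sym (toℕ-inject₁ i)))
          (ℕ.+-monoʳ-< t (s+< j′))

  isVertex⇒walk : ∀ {v} → IsVertex P v → ∃[ w ] Linked (Arc k s) w × vertexAt (choice w) ≋ v
  isVertex⇒walk v-isVertex =
    let u , J , J∈ , vJ≋v , strict = isVertex⇒selects v-isVertex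
        w , arcs , choice≡J = selects⇒walk {u} {J} J∈ strict
    in w , arcs , λ l → trans (sum-cong-≋ λ i → reflexive (≡.cong (λ j → e j l) (choice≡J i))) (vJ≋v l)

  vertexCount : HasVertexCount P (List.length (walks n))
  vertexCount = record
    { to        = vertex
    ; cong      = λ { {i} ≡.refl l → CommutativeRing.refl commutativeRing }
    ; bijective = injective , surjective
    }
    where
    linked : ∀ i → Linked (Arc k s) (List.lookup (walks n) i)
    linked i = ∈-walks⁻ (∈-lookup i)
    vertex : Fin (List.length (walks n)) → Σ (Point d) (IsVertex P)
    vertex i = vertexAt (choice (List.lookup (walks n) i)) , walk-isVertex (linked i)
    injective : ∀ {i j} → proj₁ (vertex i) ≋ proj₁ (vertex j) → i ≡ j
    injective {i} {j} eq = unique-lookup-injective (unique-walks n) i j (choice-injective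
      (selects-injective (proj₂ (functional (linked j))) (choice∈ (List.lookup (walks n) i)) eq))
    surjective : ∀ v → ∃[ i ] (∀ {j} → j ≡ i → proj₁ (vertex j) ≋ proj₁ v)
    surjective (v , v-isVertex) =
      let w , arcs , v≋ = isVertex⇒walk v-isVertex in
      Any.index (∈-walks⁺ arcs) , λ { ≡.refl → ≡.subst
        (λ w → vertexAt (choice w) ≋ v) (Any.lookup-index (∈-walks⁺ arcs)) v≋ }

open RawRing ℤ⟦x⟧ using (_≈_)

theorem4p6 :
    ∀ {c ℓ₁ ℓ₂ ℓ₃} (F : OrderedField c ℓ₁ ℓ₂ ℓ₃) (k s : ℕ) → 0 < s → s < k →
    let open Geometry F
        A = adjacency k s
    in
    Σ (ℕ → ℕ) λ b →
      (∀ n → 1 ≤ n → HasVertexCount (polytope n k s) (b n)) ×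
      ((λ n → + b (suc n)) ≈ (λ n → entrySum (A ^ᴹ n))) ×
      IsQuotient ℤ⟦x⟧ (λ n → entrySum (A ^ᴹ n)) (numerator A) (Q A)
-- Only `k = suc _` is compatible with `s < k`, and the adjugate is formed for matrices of positive
-- size.
theorem4p6 F k@(suc _) s _ _ =
  -- The choices in `n` blocks form a walk with `n ∸ 1` arcs; the value at `n = 0` is a default
  -- outside both claims.
  (λ n → List.length (Walks.walks (arc? k s) (n ∸ 1))) ,
  (λ { (suc n) _ → WalkVertices.vertexCount F k s n }) ,
  Walks.length-walks (arc? k s) ,
  ℤSeries.entrySum-quotient (adjacency k s)
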